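{- Let $G=(V,E)$ be a finite $d$-regular graph ($d\ge1$), let $\lambda_N$ be the largest eigenvalue of its normalized Laplacian and $t_1$ the smallest eigenvalue of its normalized adjacency matrix. Then $$2-\lambda_N=1+t_1\ \ge\ \frac{\left(\sqrt{1+\beta_{out}}-1\right)^2}{2d},$$ where $\beta_{out}$ is the outer vertex bipartiteness constant of $G$.
   Context: Graphs are undirected and may contain self-loops; $x\sim y$ means $\{x,y\}\in E$ ($x\sim x$ if there is a self-loop at $x$). The degree of $x$ is $|\{y: y\sim x\}|$ (a self-loop counts once). For a $d$-regular graph the normalized adjacency matrix is $\frac1dA$, with $A_{xy}=1$ if $x\sim y$ and $0$ otherwise, and the normalized Laplacian is $I-\frac1dA$. For $V_1\subseteq V$, $\partial_{out}(V_1)=\{y\in V\setminus V_1:\exists\,x\in V_1,\ x\sim y\}$. For $L\subseteq V$, $I(L)=|\{x\in L:\exists\,y\in L,\ y\sim x\}|$. The outer vertex bipartiteness constant is $$\beta_{out}=\min_{L,R\subseteq V,\ L\cap R=\emptyset,\ L\cup R\ne\emptyset}\frac{I(L)+I(R)+|\partial_{out}(L\cup R)|}{|L\cup R|}.$$ -}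

module Defs where

open import Level using (0ℓ)
open import Data.Bool.Base using (if_then_else_)
open import Data.Nat.Base as ℕ using (ℕ; zero; suc)
import Data.Nat.Properties as ℕ
import Data.Nat.Tactic.RingSolver as ℕRing
open import Data.Integer.Base as ℤ using (ℤ; +_)
import Data.Integer.Properties as ℤ
import Data.Integer.Tactic.RingSolver as ℤRing
open import Data.Rational.Base as ℚ using (ℚ; 0ℚ; 1ℚ; ½)
import Data.Rational.Properties as ℚ
import Data.Rational.Unnormalised.Base as ℚᵘ
import Data.Rational.Unnormalised.Properties as ℚᵘ
open import Data.Rational.Solver using (module +-*-Solver)
open import Data.Fin.Base using (Fin; zero)
open import Data.Fin.Properties using (any?; _≟_)
open import Data.Fin.Subset using
  (Subset; inside; outside; _∈_; _∩_; _∪_; ∣_∣; Empty; Nonempty; ⊤; ⊥)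
open import Data.Fin.Subset.Properties using
  (_∈?_; nonempty?; ∩-zeroʳ; ∉⊥; x∈p⇒∣p-x∣<∣p∣)
open import Data.List.Base using (List; []; _∷_; _++_; map; mapMaybe; cartesianProduct)
import Data.List.Extrema as Extrema
open import Data.Maybe.Base as Maybe using (Maybe)
open import Data.Product.Base using (∃; ∃₂; _×_; _,_; proj₁; proj₂)
open import Data.Sum.Base using (inj₁; inj₂)
import Data.Vec.Base as Vec
open Vec using (here)
open import Data.Vec.Functional using (Vector; foldr)
open import Function.Base using (_∘_)
open import Relation.Binary.Bundles using (DecTotalOrder)
open import Relation.Binary.Core using (Rel)
open import Relation.Binary.Definitions as B using (Symmetric)
open import Relation.Binary.PropositionalEquality using (_≡_; refl; sym; trans; cong; subst; subst₂)
open import Relation.Nullary.Decidable using (Dec; yes; no; does; dec⇒maybe; ¬?; _×-dec_)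
open import Relation.Nullary.Negation using (¬_; contradiction)
open import Relation.Unary as U using (Pred)

-- A real number is a Cauchy sequence of rationals; equality of reals is _≈_, not _≡_.

infixl 7 _*_ _/_
infixl 6 _+_ _-_
infix  8 -_
infix  9 _²
infix  4 _≈_ _≤_ _≥_

Cauchy : (ℕ → ℚ) → Set
Cauchy s = ∀ ε → 0ℚ ℚ.< ε →
  ∃ λ N → ∀ m n → N ℕ.≤ m → N ℕ.≤ n → ℚ.∣ s m ℚ.- s n ∣ ℚ.< ε

record ℝ : Set where
  constructor mkℝ
  field
    seq    : ℕ → ℚ
    cauchy : Cauchy seq

open ℝ public

_≈_ : Rel ℝ 0ℓ
x ≈ y = ∀ ε → 0ℚ ℚ.< ε → ∃ λ N → ∀ n → N ℕ.≤ n → ℚ.∣ seq x n ℚ.- seq y n ∣ ℚ.< ε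

_≤_ : Rel ℝ 0ℓ
x ≤ y = ∀ ε → 0ℚ ℚ.< ε → ∃ λ N → ∀ n → N ℕ.≤ n → seq x n ℚ.< seq y n ℚ.+ ε

_≥_ : Rel ℝ 0ℓ
x ≥ y = y ≤ x

0<½* : ∀ {ε} → 0ℚ ℚ.< ε → 0ℚ ℚ.< ½ ℚ.* ε
0<½* {ε} 0<ε = subst (ℚ._< ½ ℚ.* ε) (ℚ.*-zeroʳ ½) (ℚ.*-monoʳ-<-pos ½ 0<ε)

½+½ : ∀ ε → ½ ℚ.* ε ℚ.+ ½ ℚ.* ε ≡ ε
½+½ ε = trans (sym (ℚ.*-distribʳ-+ ε ½ ½)) (ℚ.*-identityˡ ε)

split-< : ∀ p q {ε} → ℚ.∣ p ∣ ℚ.< ½ ℚ.* ε → ℚ.∣ q ∣ ℚ.< ½ ℚ.* ε → ℚ.∣ p ℚ.+ q ∣ ℚ.< ε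
split-< p q {ε} p< q< = ℚ.≤-<-trans (ℚ.∣p+q∣≤∣p∣+∣q∣ p q)
  (subst (ℚ.∣ p ∣ ℚ.+ ℚ.∣ q ∣ ℚ.<_) (½+½ ε) (ℚ.+-mono-< p< q<))

⊔ˡ : ∀ {a b c} → a ℕ.⊔ b ℕ.≤ c → a ℕ.≤ c
⊔ˡ {a} {b} = ℕ.m⊔n≤o⇒m≤o a b

⊔ʳ : ∀ {a b c} → a ℕ.⊔ b ℕ.≤ c → b ℕ.≤ c
⊔ʳ {a} {b} = ℕ.m⊔n≤o⇒n≤o a b

fromℚ : ℚ → ℝ
fromℚ q = mkℝ (λ _ → q) λ ε 0<ε →
  0 , λ _ _ _ _ → subst (ℚ._< ε) (cong ℚ.∣_∣ (sym (ℚ.+-inverseʳ q))) 0<ε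

0ℝ 1ℝ 2ℝ : ℝ
0ℝ = fromℚ 0ℚ
1ℝ = fromℚ 1ℚ
2ℝ = fromℚ (+ 2 ℚ./ 1)

_+_ : ℝ → ℝ → ℝ
x + y = mkℝ (λ n → seq x n ℚ.+ seq y n) λ ε 0<ε →
  let M , x< = cauchy x (½ ℚ.* ε) (0<½* 0<ε)
      N , y< = cauchy y (½ ℚ.* ε) (0<½* 0<ε)
  in M ℕ.⊔ N , λ m n ≤m ≤n → subst (λ z → ℚ.∣ z ∣ ℚ.< ε)
       (rearrange (seq x m) (seq x n) (seq y m) (seq y n))
       (split-< (seq x m ℚ.- seq x n) (seq y m ℚ.- seq y n)
         (x< m n (⊔ˡ ≤m) (⊔ˡ ≤n)) (y< m n (⊔ʳ {M} ≤m) (⊔ʳ {M} ≤n)))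
  where
  rearrange : ∀ a c b d → (a ℚ.- c) ℚ.+ (b ℚ.- d) ≡ (a ℚ.+ b) ℚ.- (c ℚ.+ d)
  rearrange = solve 4 (λ a c b d → (a :- c) :+ (b :- d) := (a :+ b) :- (c :+ d)) refl
    where open +-*-Solver

-_ : ℝ → ℝ
- x = mkℝ (λ n → ℚ.- seq x n) λ ε 0<ε →
  let N , x< = cauchy x ε 0<ε
  in N , λ m n ≤m ≤n → subst (ℚ._< ε)
       (trans (sym (ℚ.∣-p∣≡∣p∣ (seq x m ℚ.- seq x n)))
              (cong ℚ.∣_∣ (ℚ.neg-distrib-+ (seq x m) (ℚ.- seq x n))))
       (x< m n ≤m ≤n)

_-_ : ℝ → ℝ → ℝ
x - y = x + (- y)

bound : ∀ x → ∃ λ B → ∃ λ N → 0ℚ ℚ.< B × (∀ n → N ℕ.≤ n → ℚ.∣ seq x n ∣ ℚ.≤ B)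
bound x = B , N , 0<B , below
  where
  N = proj₁ (cauchy x 1ℚ (ℚ.positive⁻¹ 1ℚ))
  B = 1ℚ ℚ.+ ℚ.∣ seq x N ∣
  0<B : 0ℚ ℚ.< B
  0<B = ℚ.+-mono-<-≤ (ℚ.positive⁻¹ 1ℚ) (ℚ.0≤∣p∣ (seq x N))
  cancel : ∀ a b → (a ℚ.- b) ℚ.+ b ≡ a
  cancel = solve 2 (λ a b → (a :- b) :+ b := a) refl where open +-*-Solver
  below : ∀ n → N ℕ.≤ n → ℚ.∣ seq x n ∣ ℚ.≤ B
  below n ≤n = subst (λ z → ℚ.∣ z ∣ ℚ.≤ B) (cancel (seq x n) (seq x N))
    (ℚ.≤-trans (ℚ.∣p+q∣≤∣p∣+∣q∣ (seq x n ℚ.- seq x N) (seq x N))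
      (ℚ.+-monoˡ-≤ ℚ.∣ seq x N ∣
        (ℚ.<⇒≤ (proj₂ (cauchy x 1ℚ (ℚ.positive⁻¹ 1ℚ)) n N ≤n ℕ.≤-refl))))

scale : ∀ {B ε} → 0ℚ ℚ.< B → 0ℚ ℚ.< ε → ∃ λ δ → 0ℚ ℚ.< δ ×
        (∀ p q → ℚ.∣ p ∣ ℚ.≤ B → ℚ.∣ q ∣ ℚ.< δ → ℚ.∣ p ℚ.* q ∣ ℚ.< ε)
scale {B} {ε} 0<B 0<ε = δ , 0<δ , λ p q p≤ q< →
  subst (ℚ._< ε) (sym (ℚ.∣p*q∣≡∣p∣*∣q∣ p q))
    (ℚ.≤-<-trans
      (ℚ.*-monoʳ-≤-nonNeg ℚ.∣ q ∣ {{ℚ.∣-∣-nonNeg q}} p≤)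
      (subst (B ℚ.* ℚ.∣ q ∣ ℚ.<_) Bδ≡ε (ℚ.*-monoʳ-<-pos B q<)))
  where
  instance
    B⁺ = ℚ.positive 0<B
    B≢0 = ℚ.pos⇒nonZero B
    B⁻¹⁺ = ℚ.1/pos⇒pos B
  δ = (ℚ.1/ B) ℚ.* ε
  0<δ : 0ℚ ℚ.< δ
  0<δ = subst (ℚ._< δ) (ℚ.*-zeroʳ (ℚ.1/ B)) (ℚ.*-monoʳ-<-pos (ℚ.1/ B) 0<ε)
  Bδ≡ε : B ℚ.* δ ≡ ε
  Bδ≡ε = trans (sym (ℚ.*-assoc B (ℚ.1/ B) ε))
    (trans (cong (ℚ._* ε) (ℚ.*-inverseʳ B)) (ℚ.*-identityˡ ε))

_*_ : ℝ → ℝ → ℝ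
x * y = mkℝ (λ n → seq x n ℚ.* seq y n) λ ε 0<ε →
  let Bx , Mx , 0<Bx , x≤ = bound x
      By , My , 0<By , y≤ = bound y
      δy , 0<δy , x*< = scale 0<Bx (0<½* 0<ε)
      δx , 0<δx , y*< = scale 0<By (0<½* 0<ε)
      Nx , x< = cauchy x δx 0<δx
      Ny , y< = cauchy y δy 0<δy
  in (Mx ℕ.⊔ Ny) ℕ.⊔ (My ℕ.⊔ Nx) , λ m n ≤m ≤n → subst (λ z → ℚ.∣ z ∣ ℚ.< ε)
       (rearrange (seq x m) (seq x n) (seq y m) (seq y n))
       (split-< (seq x m ℚ.* (seq y m ℚ.- seq y n)) (seq y n ℚ.* (seq x m ℚ.- seq x n))
         (x*< (seq x m) _ (x≤ m (⊔ˡ (⊔ˡ ≤m)))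
              (y< m n (⊔ʳ {Mx} (⊔ˡ ≤m)) (⊔ʳ {Mx} (⊔ˡ ≤n))))
         (y*< (seq y n) _ (y≤ n (⊔ˡ (⊔ʳ {Mx ℕ.⊔ Ny} ≤n)))
              (x< m n (⊔ʳ {My} (⊔ʳ {Mx ℕ.⊔ Ny} ≤m)) (⊔ʳ {My} (⊔ʳ {Mx ℕ.⊔ Ny} ≤n)))))
  where
  rearrange : ∀ a c b d → a ℚ.* (b ℚ.- d) ℚ.+ d ℚ.* (a ℚ.- c) ≡ a ℚ.* b ℚ.- c ℚ.* d
  rearrange = solve 4 (λ a c b d → a :* (b :- d) :+ d :* (a :- c) := a :* b :- c :* d) refl
    where open +-*-Solver

_/_ : ℝ → (k : ℕ) .{{_ : ℕ.NonZero k}} → ℝ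
x / k = x * fromℚ (+ 1 ℚ./ k)

_² : ℝ → ℝ
x ² = x * x

∑ : ∀ {n} → Vector ℝ n → ℝ
∑ = foldr _+_ 0ℝ

isqrt : ℕ → ℕ
isqrt zero    = 0
isqrt (suc n) = if does (suc r ℕ.* suc r ℕ.≤? suc n) then suc r else r
  where r = isqrt n

isqrt-spec : ∀ n → isqrt n ℕ.* isqrt n ℕ.≤ n × n ℕ.< suc (isqrt n) ℕ.* suc (isqrt n)
isqrt-spec zero    = ℕ.z≤n , ℕ.s≤s ℕ.z≤n
isqrt-spec (suc n) = step (isqrt n) (suc (isqrt n) ℕ.* suc (isqrt n) ℕ.≤? suc n) (isqrt-spec n)
  where
  step : ∀ r (r²≤? : Dec (suc r ℕ.* suc r ℕ.≤ suc n)) →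
         let r′ = if does r²≤? then suc r else r in
         r ℕ.* r ℕ.≤ n × n ℕ.< suc r ℕ.* suc r →
         r′ ℕ.* r′ ℕ.≤ suc n × suc n ℕ.< suc r′ ℕ.* suc r′
  step r (yes r²≤) (_ , n<r²) = r²≤ ,
    ℕ.≤-<-trans n<r² (ℕ.*-mono-< (ℕ.n<1+n (suc r)) (ℕ.n<1+n (suc r)))
  step r (no  r²≰) (r²≤ , _)  = ℕ.m≤n⇒m≤1+n r²≤ , ℕ.≰⇒> r²≰

-- With q = a/b ≥ 0 and k = suc n, the approximation ⌊√(a b k²)⌋ / (b k) is
-- within 1/(b k) of √(a b) / b = √q.  For q < 0 the value is the irrelevant √∣q∣.
√-seq : ℚ → ℕ → ℚ
√-seq q n =
  + isqrt (ℤ.∣ ℚ.↥ q ∣ ℕ.* ℚ.↧ₙ q ℕ.* (suc n ℕ.* suc n)) ℚ./ (ℚ.↧ₙ q ℕ.* suc n)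

/-mono-< : ∀ a c k l .{{_ : ℕ.NonZero k}} .{{_ : ℕ.NonZero l}} →
           a ℕ.* l ℕ.< c ℕ.* k → + a ℚ./ k ℚ.< + c ℚ./ l
/-mono-< a c (suc k) (suc l) lt = ℚ.toℚᵘ-cancel-<
  (ℚᵘ.<-respˡ-≃ (ℚᵘ.≃-sym (ℚ.toℚᵘ-fromℚᵘ (ℚᵘ.mkℚᵘ (+ a) k)))
    (ℚᵘ.<-respʳ-≃ (ℚᵘ.≃-sym (ℚ.toℚᵘ-fromℚᵘ (ℚᵘ.mkℚᵘ (+ c) l)))
      (ℚᵘ.*<* (subst₂ ℤ._<_ (ℤ.pos-* a (suc l)) (ℤ.pos-* c (suc k)) (ℤ.+<+ lt)))))

/-suc : ∀ a k .{{_ : ℕ.NonZero k}} → + suc a ℚ./ k ≡ + a ℚ./ k ℚ.+ + 1 ℚ./ k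
/-suc a (suc k) = ℚ.toℚᵘ-injective (begin
  ℚ.toℚᵘ (+ suc a ℚ./ suc k)                        ≈⟨ ℚ.toℚᵘ-fromℚᵘ _ ⟩
  ℚᵘ.mkℚᵘ (+ suc a) k                               ≈⟨ ℚᵘ.*≡* (identity (+ a) (+ suc k)) ⟩
  ℚᵘ.mkℚᵘ (+ a) k ℚᵘ.+ ℚᵘ.mkℚᵘ (+ 1) k
    ≈⟨ ℚᵘ.+-cong (ℚ.toℚᵘ-fromℚᵘ (ℚᵘ.mkℚᵘ (+ a) k)) (ℚ.toℚᵘ-fromℚᵘ (ℚᵘ.mkℚᵘ (+ 1) k)) ⟨
  ℚ.toℚᵘ (+ a ℚ./ suc k) ℚᵘ.+ ℚ.toℚᵘ (+ 1 ℚ./ suc k)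
    ≈⟨ ℚ.toℚᵘ-homo-+ (+ a ℚ./ suc k) (+ 1 ℚ./ suc k) ⟨
  ℚ.toℚᵘ (+ a ℚ./ suc k ℚ.+ + 1 ℚ./ suc k)          ∎)
  where
  open import Relation.Binary.Reasoning.Setoid ℚᵘ.≃-setoid
  identity : ∀ x y → (+ 1 ℤ.+ x) ℤ.* (y ℤ.* y) ≡ (x ℤ.* y ℤ.+ + 1 ℤ.* y) ℤ.* y
  identity = ℤRing.solve-∀

isqrt-cross : ∀ c k l → let s = λ m → isqrt (c ℕ.* (suc m ℕ.* suc m)) in
              s k ℕ.* suc l ℕ.< suc (s l) ℕ.* suc k
isqrt-cross c k l = ℕ.≰⇒> λ ge → ℕ.<⇒≱ square-< (ℕ.*-mono-≤ ge ge)
  where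
  s = λ m → isqrt (c ℕ.* (suc m ℕ.* suc m))
  swap : ∀ x y → (x ℕ.* y) ℕ.* (x ℕ.* y) ≡ (x ℕ.* x) ℕ.* (y ℕ.* y)
  swap = ℕRing.solve-∀
  swap′ : ∀ c x y → (c ℕ.* (x ℕ.* x)) ℕ.* (y ℕ.* y) ≡ (c ℕ.* (y ℕ.* y)) ℕ.* (x ℕ.* x)
  swap′ = ℕRing.solve-∀
  square-< : (s k ℕ.* suc l) ℕ.* (s k ℕ.* suc l)
             ℕ.< (suc (s l) ℕ.* suc k) ℕ.* (suc (s l) ℕ.* suc k)
  square-< = begin-strict
    (s k ℕ.* suc l) ℕ.* (s k ℕ.* suc l)              ≡⟨ swap (s k) (suc l) ⟩
    (s k ℕ.* s k) ℕ.* (suc l ℕ.* suc l)              ≤⟨ ℕ.*-monoˡ-≤ (suc l ℕ.* suc l) (proj₁ (isqrt-spec (c ℕ.* (suc k ℕ.* suc k)))) ⟩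
    (c ℕ.* (suc k ℕ.* suc k)) ℕ.* (suc l ℕ.* suc l)  ≡⟨ swap′ c (suc k) (suc l) ⟩
    (c ℕ.* (suc l ℕ.* suc l)) ℕ.* (suc k ℕ.* suc k)  <⟨ ℕ.*-monoˡ-< (suc k ℕ.* suc k) (proj₂ (isqrt-spec (c ℕ.* (suc l ℕ.* suc l)))) ⟩
    (suc (s l) ℕ.* suc (s l)) ℕ.* (suc k ℕ.* suc k)  ≡⟨ swap (suc (s l)) (suc k) ⟨
    (suc (s l) ℕ.* suc k) ℕ.* (suc (s l) ℕ.* suc k)  ∎
    where open ℕ.≤-Reasoning

√-seq-< : ∀ q m n → √-seq q m ℚ.< √-seq q n ℚ.+ + 1 ℚ./ (ℚ.↧ₙ q ℕ.* suc n)
√-seq-< q m n = subst (√-seq q m ℚ.<_) (/-suc (s n) (b ℕ.* suc n))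
  (/-mono-< (s m) (suc (s n)) (b ℕ.* suc m) (b ℕ.* suc n) (begin-strict
    s m ℕ.* (b ℕ.* suc n)        ≡⟨ swap (s m) b (suc n) ⟩
    b ℕ.* (s m ℕ.* suc n)        <⟨ ℕ.*-monoʳ-< b (isqrt-cross (ℤ.∣ ℚ.↥ q ∣ ℕ.* b) m n) ⟩
    b ℕ.* (suc (s n) ℕ.* suc m)  ≡⟨ swap (suc (s n)) b (suc m) ⟨
    suc (s n) ℕ.* (b ℕ.* suc m)  ∎))
  where
  open ℕ.≤-Reasoning
  b = ℚ.↧ₙ q
  s = λ m → isqrt (ℤ.∣ ℚ.↥ q ∣ ℕ.* b ℕ.* (suc m ℕ.* suc m))
  swap : ∀ x b y → x ℕ.* (b ℕ.* y) ≡ b ℕ.* (x ℕ.* y)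
  swap = ℕRing.solve-∀

1/-small : ∀ ε → 0ℚ ℚ.< ε → ∀ b → ∃ λ N → ∀ n → N ℕ.≤ n → + 1 ℚ./ (suc b ℕ.* suc n) ℚ.< ε
1/-small ε@(ℚ.mkℚ (+ suc p) d _) _ b = suc d , λ n d<n →
  subst (+ 1 ℚ./ (suc b ℕ.* suc n) ℚ.<_) (ℚ.↥p/↧p≡p ε)
    (/-mono-< 1 (suc p) (suc b ℕ.* suc n) (suc d) (begin-strict
      1 ℕ.* suc d                    ≡⟨ ℕ.*-identityˡ (suc d) ⟩
      suc d                          <⟨ ℕ.s≤s d<n ⟩
      suc n                          ≤⟨ ℕ.m≤n*m (suc n) (suc b) ⟩
      suc b ℕ.* suc n                ≤⟨ ℕ.m≤n*m (suc b ℕ.* suc n) (suc p) ⟩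
      suc p ℕ.* (suc b ℕ.* suc n)    ∎))
  where open ℕ.≤-Reasoning
1/-small (ℚ.mkℚ (+ zero)   _ _) (ℚ.*<* (ℤ.+<+ ())) _
1/-small (ℚ.mkℚ ℤ.-[1+ _ ] _ _) (ℚ.*<* ()) _

∣-∣-< : ∀ {p q ε} → p ℚ.< q ℚ.+ ε → q ℚ.< p ℚ.+ ε → ℚ.∣ p ℚ.- q ∣ ℚ.< ε
∣-∣-< {p} {q} {ε} p< q< with ℚ.∣p∣≡p∨∣p∣≡-p (p ℚ.- q)
... | inj₁ eq = subst₂ ℚ._<_ (sym eq) (cancel q ε) (ℚ.+-monoˡ-< (ℚ.- q) p<)
  where
  cancel : ∀ q ε → (q ℚ.+ ε) ℚ.- q ≡ ε
  cancel = solve 2 (λ q ε → (q :+ ε) :- q := ε) refl where open +-*-Solver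
... | inj₂ eq = subst₂ ℚ._<_ (trans (flip p q) (sym eq)) (cancel p ε) (ℚ.+-monoˡ-< (ℚ.- p) q<)
  where
  open +-*-Solver
  cancel : ∀ p ε → (p ℚ.+ ε) ℚ.- p ≡ ε
  cancel = solve 2 (λ p ε → (p :+ ε) :- p := ε) refl
  flip : ∀ p q → q ℚ.- p ≡ ℚ.- (p ℚ.- q)
  flip = solve 2 (λ p q → q :- p := :- (p :- q)) refl

cauchy-from-bracket : (s η : ℕ → ℚ) → (∀ m n → s m ℚ.< s n ℚ.+ η n) →
  (∀ ε → 0ℚ ℚ.< ε → ∃ λ N → ∀ n → N ℕ.≤ n → η n ℚ.< ε) → Cauchy s
cauchy-from-bracket s η s< η→0 ε 0<ε = proj₁ (η→0 ε 0<ε) , λ m n ≤m ≤n → ∣-∣-< {s m} {s n}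
  (ℚ.<-trans (s< m n) (ℚ.+-monoʳ-< (s n) (proj₂ (η→0 ε 0<ε) n ≤n)))
  (ℚ.<-trans (s< n m) (ℚ.+-monoʳ-< (s m) (proj₂ (η→0 ε 0<ε) m ≤m)))

√ : ℚ → ℝ
√ q = mkℝ (√-seq q)
  (cauchy-from-bracket (√-seq q) (λ n → + 1 ℚ./ (ℚ.↧ₙ q ℕ.* suc n)) (√-seq-< q)
    λ ε 0<ε → 1/-small ε 0<ε (ℚ.ℚ.denominator-1 q))

Matrix : ℕ → Set
Matrix n = Fin n → Fin n → ℝ

_·_ : ∀ {n} → Matrix n → Vector ℝ n → Vector ℝ n
(M · v) i = ∑ λ j → M i j * v j

identityMatrix : ∀ {n} → Matrix n
identityMatrix i j = if does (i ≟ j) then 1ℝ else 0ℝ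

IsEigenvalue : ∀ {n} → Matrix n → ℝ → Set
IsEigenvalue M μ =
  ∃ λ v → ¬ (∀ i → v i ≈ 0ℝ) × (∀ i → (M · v) i ≈ μ * v i)

IsLargestEigenvalue : ∀ {n} → Matrix n → ℝ → Set
IsLargestEigenvalue M μ = IsEigenvalue M μ × (∀ ν → IsEigenvalue M ν → ν ≤ μ)

IsSmallestEigenvalue : ∀ {n} → Matrix n → ℝ → Set
IsSmallestEigenvalue M μ = IsEigenvalue M μ × (∀ ν → IsEigenvalue M ν → μ ≤ ν)

record Graph (n : ℕ) : Set₁ where
  field
    _∼_   : Rel (Fin n) 0ℓ
    _∼?_  : B.Decidable _∼_
    ∼-sym : Symmetric _∼_

subset : ∀ {n} {P : Pred (Fin n) 0ℓ} → U.Decidable P → Subset n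
subset P? = Vec.tabulate (does ∘ P?)

module _ {n} (G : Graph n) where
  open Graph G

  degree : Fin n → ℕ
  degree x = ∣ subset (λ y → y ∼? x) ∣

  Regular : ℕ → Set
  Regular d = ∀ x → degree x ≡ d

  adjacency : Matrix n
  adjacency x y = if does (x ∼? y) then 1ℝ else 0ℝ

  normalizedAdjacency : (d : ℕ) .{{_ : ℕ.NonZero d}} → Matrix n
  normalizedAdjacency d x y = adjacency x y / d

  normalizedLaplacian : (d : ℕ) .{{_ : ℕ.NonZero d}} → Matrix n
  normalizedLaplacian d x y = identityMatrix x y - normalizedAdjacency d x y

  ∂out : Subset n → Subset n
  ∂out V₁ = subset λ y → ¬? (y ∈? V₁) ×-dec any? λ x → (x ∈? V₁) ×-dec (x ∼? y)

  I : Subset n → ℕ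
  I L = ∣ subset (λ x → (x ∈? L) ×-dec any? λ y → (y ∈? L) ×-dec (y ∼? x)) ∣

∣∣-nonZero : ∀ {n} {S : Subset n} → Nonempty S → ℕ.NonZero ∣ S ∣
∣∣-nonZero (x , x∈S) = ℕ.>-nonZero (ℕ.≤-<-trans ℕ.z≤n (x∈p⇒∣p-x∣<∣p∣ x∈S))

Admissible : ∀ {n} → Subset n × Subset n → Set
Admissible (L , R) = Empty (L ∩ R) × Nonempty (L ∪ R)

admissible? : ∀ {n} → U.Decidable (Admissible {n})
admissible? (L , R) = ¬? (nonempty? (L ∩ R)) ×-dec nonempty? (L ∪ R)

bipartitenessRatio : ∀ {n} → Graph n → (LR : Subset n × Subset n) → Admissible LR → ℚ
bipartitenessRatio G (L , R) (_ , L∪R≢∅) =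
  ((+ (I G L ℕ.+ I G R ℕ.+ ∣ ∂out G (L ∪ R) ∣)) ℚ./ ∣ L ∪ R ∣) {{∣∣-nonZero L∪R≢∅}}

subsets : ∀ n → List (Subset n)
subsets zero    = Vec.[] ∷ []
subsets (suc n) = map (outside Vec.∷_) (subsets n) ++ map (inside Vec.∷_) (subsets n)

bipartitenessRatios : ∀ {n} → Graph n → List ℚ
bipartitenessRatios {n} G =
  mapMaybe (λ LR → Maybe.map (bipartitenessRatio G LR) (dec⇒maybe (admissible? LR)))
           (cartesianProduct (subsets n) (subsets n))

V,∅-admissible : ∀ {n} → Admissible {suc n} (⊤ , ⊥)
V,∅-admissible = (λ (x , x∈) → ∉⊥ (subst (x ∈_) (∩-zeroʳ ⊤) x∈)) , zero , here

-- min takes a default element besides the list; the ratio at (V , ∅) is itself one of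
-- the ratios, so it does not affect the minimum.
βout : ∀ {n} → Graph (suc n) → ℚ
βout G = min (bipartitenessRatio G (⊤ , ⊥) V,∅-admissible) (bipartitenessRatios G)
  where open Extrema (DecTotalOrder.totalOrder ℚ.≤-decTotalOrder) using (min)

module _ where
  open Extrema (DecTotalOrder.totalOrder ℚ.≤-decTotalOrder)
  open import Data.List.Membership.Propositional using () renaming (_∈_ to _∈ˡ_)
  open import Data.List.Membership.Propositional.Properties
    using (∈-map⁺; ∈-++⁺ˡ; ∈-++⁺ʳ; ∈-cartesianProduct⁺)
  import Data.List.Relation.Unary.Any as Any
  import Data.List.Relation.Unary.Any.Properties as Any
  import Data.List.Relation.Unary.All as All
  import Data.List.Relation.Unary.All.Properties as All
  import Data.Maybe.Relation.Unary.Any as MAny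
  import Data.Maybe.Relation.Unary.All as MAll

  ∈-subsets : ∀ {n} (S : Subset n) → S ∈ˡ subsets n
  ∈-subsets Vec.[]              = Any.here refl
  ∈-subsets (outside Vec.∷ S)   = ∈-++⁺ˡ (∈-map⁺ (outside Vec.∷_) (∈-subsets S))
  ∈-subsets (inside  Vec.∷ S)   =
    ∈-++⁺ʳ (map (outside Vec.∷_) (subsets _)) (∈-map⁺ (inside Vec.∷_) (∈-subsets S))

  βout-≤ : ∀ {n} (G : Graph (suc n)) LR (a : Admissible LR) → βout G ℚ.≤ bipartitenessRatio G LR a
  βout-≤ {n} G LR@(L , R) a = min≤v⁺ _ (bipartitenessRatios G) (inj₂
    (Any.mapMaybe⁺ _ _ (Any.map⁺ (Any.map here′
      (∈-cartesianProduct⁺ (∈-subsets L) (∈-subsets R))))))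
    where
    found : ∀ {A : Set} {f : A → ℚ} (a? : Dec A) a → (∀ a′ → f a′ ≡ f a) →
            MAny.Any (ℚ._≤ f a) (Maybe.map f (dec⇒maybe a?))
    found (yes a′) a irr = MAny.just (ℚ.≤-reflexive (irr a′))
    found (no ¬a)  a irr = contradiction a ¬a
    here′ : ∀ {LR′} → LR ≡ LR′ →
            MAny.Any (ℚ._≤ bipartitenessRatio G LR a)
              (Maybe.map (bipartitenessRatio G LR′) (dec⇒maybe (admissible? LR′)))
    here′ refl = found {f = bipartitenessRatio G LR} (admissible? LR) a (λ _ → refl)

  βout-attained : ∀ {n} (G : Graph (suc n)) → ∃₂ λ LR a → βout G ≡ bipartitenessRatio G LR a
  βout-attained {n} G = argmin-all (λ q → q) {xs = bipartitenessRatios G}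
    {P = λ q → ∃₂ λ LR a → q ≡ bipartitenessRatio G LR a}
    ((⊤ , ⊥) , V,∅-admissible , refl)
    (All.mapMaybe⁺ {f = λ LR → Maybe.map (bipartitenessRatio G LR) (dec⇒maybe (admissible? LR))}
      (All.map⁺ (All.universal ratio (cartesianProduct (subsets (suc n)) (subsets (suc n))))))
    where
    all : ∀ {A : Set} {f : A → ℚ} {P : ℚ → Set} (a? : Dec A) → (∀ a → P (f a)) →
          MAll.All P (Maybe.map f (dec⇒maybe a?))
    all (yes a) pf = MAll.just (pf a)
    all (no _)  pf = MAll.nothing
    ratio : ∀ LR → MAll.All (λ q → ∃₂ λ LR a → q ≡ bipartitenessRatio G LR a)
              (Maybe.map (bipartitenessRatio G LR) (dec⇒maybe (admissible? LR)))
    ratio LR = all (admissible? LR) λ a → LR , a , refl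

{-# OPTIONS --safe #-}

-- For a vector v with A v = d t v (A the adjacency matrix), d-regularity gives
-- 2d (1 + t) Σ v(x)² = S(v), where S(v) = Σ (v(x) + v(y))² over ordered pairs x ∼ y.
-- Cut v at height s into L = {v ≥ 0, v² > s} and R = {v < 0, v² > s} and integrate
-- I(L) + I(R) + |∂out(L ∪ R)| ≥ β |L ∪ R| over s.  A vertex x contributes at most
-- v(y)² for some neighbour y on its own side and v(z)² - v(x)² for some neighbour z on
-- the other side, which gives, for all u ≥ 0,
--   u β Σ v² ≤ (1 + u) S(v) + u² Σ v²,
-- and u = √(1 + β) - 1 turns this into S(v) ≥ u² Σ v².
--
-- Rational vectors suffice: the n-th approximation of √(1 + β) is a lower bound, so the
-- inequality S(v) ≥ u² Σ v² holds for the n-th approximations of v and u, for every n.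

module Submission where

open import Algebra.Bundles using (CommutativeRing)
import Algebra.Properties.Semiring.Sum as Sum
open import Data.Bool.Base using (Bool; true; false; if_then_else_)
import Data.Bool.Properties as Bool
open import Data.Fin.Base using (Fin; zero; suc; toℕ)
open import Data.Fin.Properties using (any?; _≟_)
open import Data.Fin.Subset using (Subset; _∈_; _∪_; _∩_; ∣_∣; Empty; Nonempty)
open import Data.Fin.Subset.Properties using
  (_∈?_; nonempty?; Empty-unique; ∣⊥∣≡0; ⊆-antisym; x∈p∩q⁺; x∈p∩q⁻; x∈p∪q⁺; x∈p∪q⁻)
open import Data.Integer.Base as ℤ using (+_; -[1+_])
import Data.Integer.Properties as ℤ
open import Data.Nat.Base as ℕ using (ℕ; zero; suc)
import Data.Nat.Properties as ℕ
open import Data.Nat.Properties using (m*n≢0)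
import Data.Nat.Tactic.RingSolver as ℕRing
open import Data.Product.Base using (∃; ∃₂; _×_; _,_; proj₁; proj₂)
open import Data.Rational.Base as ℚ using (ℚ; 0ℚ; 1ℚ; ½)
import Data.Rational.Properties as ℚ
open import Data.Rational.Solver using (module +-*-Solver)
import Data.Rational.Unnormalised.Base as ℚᵘ
open import Data.Sum.Base using (_⊎_; inj₁; inj₂; [_,_]′)
import Data.Vec.Base as Vec
open import Data.Vec.Properties using (lookup⇒[]=; []=⇒lookup; lookup∘tabulate)
open import Data.Vec.Functional using (Vector)
open import Function.Base using (_∘_; case_of_)
open import Relation.Binary.PropositionalEquality
open import Relation.Nullary.Decidable using (Dec; yes; no; does; ¬?; _×-dec_; dec-true; dec-false)
open import Relation.Nullary.Negation using (¬_; contradiction)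
import Relation.Unary as U
open import Defs

open +-*-Solver using (solve; _:=_; _:+_; _:*_; _:-_; :-_; con)

module ℕΣ = Sum ℕ.+-*-semiring
module ℚΣ = Sum (CommutativeRing.semiring ℚ.+-*-commutativeRing)

open ℕΣ using () renaming (sum to ∑ℕ)
open ℚΣ using () renaming (sum to ∑ℚ)

-- Rational arithmetic and finite sums

-- Reduces an inequality to a ring identity: `r` is an explicit nonnegative slack, and the equation
-- can be left to the solver.
p+r≡q⇒p≤q : ∀ {p q r} → 0ℚ ℚ.≤ r → p ℚ.+ r ≡ q → p ℚ.≤ q
p+r≡q⇒p≤q {p} {r = r} 0≤r refl =
  subst (ℚ._≤ p ℚ.+ r) (ℚ.+-identityʳ p) (ℚ.+-monoʳ-≤ p 0≤r)

0≤p*q : ∀ {p q} → 0ℚ ℚ.≤ p → 0ℚ ℚ.≤ q → 0ℚ ℚ.≤ p ℚ.* q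
0≤p*q {p} {q} 0≤p 0≤q = subst (ℚ._≤ p ℚ.* q) (ℚ.*-zeroʳ p)
  (ℚ.*-monoˡ-≤-nonNeg p {{ℚ.nonNegative 0≤p}} 0≤q)

p≤0,q≤0⇒0≤p*q : ∀ {p q} → p ℚ.≤ 0ℚ → q ℚ.≤ 0ℚ → 0ℚ ℚ.≤ p ℚ.* q
p≤0,q≤0⇒0≤p*q {p} {q} p≤0 q≤0 = subst (ℚ._≤ p ℚ.* q) (ℚ.*-zeroʳ p)
  (ℚ.*-monoˡ-≤-nonPos p {{ℚ.nonPositive p≤0}} q≤0)

0≤p² : ∀ p → 0ℚ ℚ.≤ p ℚ.* p
0≤p² p = [ (λ 0≤p → 0≤p*q 0≤p 0≤p) , (λ p≤0 → p≤0,q≤0⇒0≤p*q p≤0 p≤0) ]′ (ℚ.≤-total 0ℚ p)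

0≤p+q : ∀ {p q} → 0ℚ ℚ.≤ p → 0ℚ ℚ.≤ q → 0ℚ ℚ.≤ p ℚ.+ q
0≤p+q = ℚ.+-mono-≤

0≤1 : 0ℚ ℚ.≤ 1ℚ
0≤1 = ℚ.nonNegative⁻¹ 1ℚ

p≤q⇒0≤q-p : ∀ {p q} → p ℚ.≤ q → 0ℚ ℚ.≤ q ℚ.- p
p≤q⇒0≤q-p {p} {q} p≤q = subst (ℚ._≤ q ℚ.- p) (ℚ.+-inverseʳ p) (ℚ.+-monoˡ-≤ (ℚ.- p) p≤q)

ι : ℕ → ℚ
ι k = + k ℚ./ 1

ι-suc : ∀ k → ι (suc k) ≡ ι k ℚ.+ 1ℚ
ι-suc k = /-suc k 1

ι-+ : ∀ a b → ι (a ℕ.+ b) ≡ ι a ℚ.+ ι b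
ι-+ zero    b = sym (ℚ.+-identityˡ (ι b))
ι-+ (suc a) b = begin
  ι (suc (a ℕ.+ b))       ≡⟨ ι-suc (a ℕ.+ b) ⟩
  ι (a ℕ.+ b) ℚ.+ 1ℚ      ≡⟨ cong (ℚ._+ 1ℚ) (ι-+ a b) ⟩
  ι a ℚ.+ ι b ℚ.+ 1ℚ      ≡⟨ solve 2 (λ x y → x :+ y :+ con 1ℚ := x :+ con 1ℚ :+ y) refl (ι a) (ι b) ⟩
  ι a ℚ.+ 1ℚ ℚ.+ ι b      ≡⟨ cong (ℚ._+ ι b) (ι-suc a) ⟨
  ι (suc a) ℚ.+ ι b       ∎
  where open ≡-Reasoning

ι-* : ∀ a b → ι (a ℕ.* b) ≡ ι a ℚ.* ι b
ι-* zero    b = sym (ℚ.*-zeroˡ (ι b))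
ι-* (suc a) b = begin
  ι (b ℕ.+ a ℕ.* b)       ≡⟨ ι-+ b (a ℕ.* b) ⟩
  ι b ℚ.+ ι (a ℕ.* b)     ≡⟨ cong (ι b ℚ.+_) (ι-* a b) ⟩
  ι b ℚ.+ ι a ℚ.* ι b     ≡⟨ solve 2 (λ x y → y :+ x :* y := (x :+ con 1ℚ) :* y) refl (ι a) (ι b) ⟩
  (ι a ℚ.+ 1ℚ) ℚ.* ι b    ≡⟨ cong (ℚ._* ι b) (ι-suc a) ⟨
  ι (suc a) ℚ.* ι b       ∎
  where open ≡-Reasoning

0≤ι : ∀ k → 0ℚ ℚ.≤ ι k
0≤ι zero    = ℚ.≤-refl
0≤ι (suc k) = subst (0ℚ ℚ.≤_) (sym (ι-suc k)) (0≤p+q (0≤ι k) 0≤1)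

0<ι : ∀ k .{{_ : ℕ.NonZero k}} → 0ℚ ℚ.< ι k
0<ι (suc k) = subst (0ℚ ℚ.<_) (sym (ι-suc k)) (ℚ.+-mono-≤-< (0≤ι k) (ℚ.positive⁻¹ 1ℚ))

ι-mono-≤ : ∀ {a b} → a ℕ.≤ b → ι a ℚ.≤ ι b
ι-mono-≤ {a} {b} a≤b = p+r≡q⇒p≤q (0≤ι (b ℕ.∸ a))
  (trans (sym (ι-+ a (b ℕ.∸ a))) (cong ι (ℕ.m+[n∸m]≡n a≤b)))

/≡ι* : ∀ a k .{{_ : ℕ.NonZero k}} → + a ℚ./ k ≡ ι a ℚ.* (+ 1 ℚ./ k)
/≡ι* zero    k = trans (ℚ.0/n≡0 k) (sym (ℚ.*-zeroˡ (+ 1 ℚ./ k)))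
/≡ι* (suc a) k = begin
  + suc a ℚ./ k                              ≡⟨ /-suc a k ⟩
  + a ℚ./ k ℚ.+ + 1 ℚ./ k                    ≡⟨ cong (ℚ._+ + 1 ℚ./ k) (/≡ι* a k) ⟩
  ι a ℚ.* (+ 1 ℚ./ k) ℚ.+ + 1 ℚ./ k          ≡⟨ solve 2 (λ x r → x :* r :+ r := (x :+ con 1ℚ) :* r) refl (ι a) (+ 1 ℚ./ k) ⟩
  (ι a ℚ.+ 1ℚ) ℚ.* (+ 1 ℚ./ k)               ≡⟨ cong (ℚ._* (+ 1 ℚ./ k)) (ι-suc a) ⟨
  ι (suc a) ℚ.* (+ 1 ℚ./ k)                  ∎
  where open ≡-Reasoning

ι*1/ : ∀ k .{{_ : ℕ.NonZero k}} → ι k ℚ.* (+ 1 ℚ./ k) ≡ 1ℚ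
ι*1/ k@(suc k-1) = trans (sym (/≡ι* k k))
  (ℚ.fromℚᵘ-cong {ℚᵘ.mkℚᵘ (+ k) k-1} {ℚᵘ.mkℚᵘ (+ 1) 0}
    (ℚᵘ.*≡* (trans (ℤ.*-identityʳ (+ k)) (sym (ℤ.*-identityˡ (+ k))))))

/*ι : ∀ a k .{{_ : ℕ.NonZero k}} → (+ a ℚ./ k) ℚ.* ι k ≡ ι a
/*ι a k = begin
  (+ a ℚ./ k) ℚ.* ι k              ≡⟨ cong (ℚ._* ι k) (/≡ι* a k) ⟩
  ι a ℚ.* (+ 1 ℚ./ k) ℚ.* ι k      ≡⟨ solve 3 (λ x r y → x :* r :* y := x :* (y :* r)) refl (ι a) (+ 1 ℚ./ k) (ι k) ⟩
  ι a ℚ.* (ι k ℚ.* (+ 1 ℚ./ k))    ≡⟨ cong (ι a ℚ.*_) (ι*1/ k) ⟩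
  ι a ℚ.* 1ℚ                       ≡⟨ ℚ.*-identityʳ (ι a) ⟩
  ι a                              ∎
  where open ≡-Reasoning

↥≡*↧ : ∀ q → 0ℚ ℚ.≤ q → ι ℤ.∣ ℚ.↥ q ∣ ≡ q ℚ.* ι (ℚ.↧ₙ q)
↥≡*↧ q@(ℚ.mkℚ (+ a) d _) _ =
  trans (sym (/*ι a (suc d))) (cong (ℚ._* ι (suc d)) (ℚ.↥p/↧p≡p q))
↥≡*↧ (ℚ.mkℚ -[1+ _ ] _ _) (ℚ.*≤* ())

ι-∑ : ∀ {n} (f : Vector ℕ n) → ι (∑ℕ f) ≡ ∑ℚ (ι ∘ f)
ι-∑ {zero}  f = refl
ι-∑ {suc n} f = trans (ι-+ (f zero) (∑ℕ (f ∘ suc))) (cong (ι (f zero) ℚ.+_) (ι-∑ (f ∘ suc)))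

∑ℕ-mono-≤ : ∀ {n} {f g : Vector ℕ n} → (∀ i → f i ℕ.≤ g i) → ∑ℕ f ℕ.≤ ∑ℕ g
∑ℕ-mono-≤ {zero}  f≤g = ℕ.≤-refl
∑ℕ-mono-≤ {suc n} f≤g = ℕ.+-mono-≤ (f≤g zero) (∑ℕ-mono-≤ (f≤g ∘ suc))

term≤∑ℕ : ∀ {n} (f : Vector ℕ n) i → f i ℕ.≤ ∑ℕ f
term≤∑ℕ f zero    = ℕ.m≤m+n (f zero) _
term≤∑ℕ f (suc i) = ℕ.≤-trans (term≤∑ℕ (f ∘ suc) i) (ℕ.m≤n+m _ (f zero))

∑ℚ-mono-≤ : ∀ {n} {f g : Vector ℚ n} → (∀ i → f i ℚ.≤ g i) → ∑ℚ f ℚ.≤ ∑ℚ g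
∑ℚ-mono-≤ {zero}  f≤g = ℚ.≤-refl
∑ℚ-mono-≤ {suc n} f≤g = ℚ.+-mono-≤ (f≤g zero) (∑ℚ-mono-≤ (f≤g ∘ suc))

0≤∑ℚ : ∀ {n} {f : Vector ℚ n} → (∀ i → 0ℚ ℚ.≤ f i) → 0ℚ ℚ.≤ ∑ℚ f
0≤∑ℚ {zero}  0≤f = ℚ.≤-refl
0≤∑ℚ {suc n} 0≤f = 0≤p+q (0≤f zero) (0≤∑ℚ (0≤f ∘ suc))

term≤∑ℚ : ∀ {n} {f : Vector ℚ n} → (∀ i → 0ℚ ℚ.≤ f i) → ∀ i → f i ℚ.≤ ∑ℚ f
term≤∑ℚ {f = f} 0≤f zero    = p+r≡q⇒p≤q (0≤∑ℚ (0≤f ∘ suc)) refl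
term≤∑ℚ {f = f} 0≤f (suc i) = ℚ.≤-trans (term≤∑ℚ (0≤f ∘ suc) i)
  (p+r≡q⇒p≤q (0≤f zero) (ℚ.+-comm (∑ℚ (f ∘ suc)) (f zero)))

-- Turns rational squares into natural heights `k`, so that integration over the height of the cut
-- becomes a finite sum. `D` is the product of the denominators.
common-denominator : ∀ {n} (g : Vector ℚ n) → (∀ i → 0ℚ ℚ.≤ g i) →
  ∃₂ λ D (k : Vector ℕ n) → ℕ.NonZero D × (∀ i → ι (k i) ≡ ι D ℚ.* g i)
common-denominator {zero}  g 0≤g = 1 , (λ ()) , _ , λ ()
common-denominator {suc n} g 0≤g =
  let D , k , D≢0 , k≡ = common-denominator (g ∘ suc) (0≤g ∘ suc)
      a = ℤ.∣ ℚ.↥ g zero ∣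
      b = ℚ.↧ₙ (g zero)
  in D ℕ.* b
   , (λ { zero → D ℕ.* a ; (suc i) → k i ℕ.* b })
   , m*n≢0 D b {{D≢0}}
   , λ { zero → begin
           ι (D ℕ.* a)                    ≡⟨ ι-* D a ⟩
           ι D ℚ.* ι a                    ≡⟨ cong (ι D ℚ.*_) (↥≡*↧ (g zero) (0≤g zero)) ⟩
           ι D ℚ.* (g zero ℚ.* ι b)       ≡⟨ rearrange (ι D) (g zero) (ι b) ⟩
           ι D ℚ.* ι b ℚ.* g zero         ≡⟨ cong (ℚ._* g zero) (ι-* D b) ⟨
           ι (D ℕ.* b) ℚ.* g zero         ∎
       ; (suc i) → begin
           ι (k i ℕ.* b)                  ≡⟨ ι-* (k i) b ⟩
           ι (k i) ℚ.* ι b                ≡⟨ cong (ℚ._* ι b) (k≡ i) ⟩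
           ι D ℚ.* g (suc i) ℚ.* ι b      ≡⟨ ℚ.*-assoc (ι D) (g (suc i)) (ι b) ⟩
           ι D ℚ.* (g (suc i) ℚ.* ι b)    ≡⟨ rearrange (ι D) (g (suc i)) (ι b) ⟩
           ι D ℚ.* ι b ℚ.* g (suc i)      ≡⟨ cong (ℚ._* g (suc i)) (ι-* D b) ⟨
           ι (D ℕ.* b) ℚ.* g (suc i)      ∎ }
  where
  open ≡-Reasoning
  rearrange : ∀ x y z → x ℚ.* (y ℚ.* z) ≡ x ℚ.* z ℚ.* y
  rearrange = solve 3 (λ x y z → x :* (y :* z) := x :* z :* y) refl

-- Counting

𝟙 : ∀ {p} {P : Set p} → Dec P → ℕ
𝟙 P? = if does P? then 1 else 0

𝟙-cong : ∀ {P Q : Set} (P? : Dec P) (Q? : Dec Q) → (P → Q) → (Q → P) → 𝟙 P? ≡ 𝟙 Q?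
𝟙-cong (yes p) (yes q) _ _ = refl
𝟙-cong (yes p) (no ¬q) f _ = contradiction (f p) ¬q
𝟙-cong (no ¬p) (yes q) _ g = contradiction (g q) ¬p
𝟙-cong (no ¬p) (no ¬q) _ _ = refl

-- At most one of `A`, `B`, `C` holds, so the left side is at most 1, and whichever holds makes the
-- right side at least 1. The three cases will be a vertex internal to L, internal to R, or on the
-- outer boundary.
𝟙-exclusive : ∀ {A B C P Q : Set}
  (A? : Dec A) (B? : Dec B) (C? : Dec C) (P? : Dec P) (Q? : Dec Q) →
  (A → ¬ B) → (A → ¬ C) → (B → ¬ C) → (A → P) → (B → P) → (C → P ⊎ Q) →
  𝟙 A? ℕ.+ 𝟙 B? ℕ.+ 𝟙 C? ℕ.≤ 𝟙 P? ℕ.+ 𝟙 Q?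
𝟙-exclusive (yes a) (yes b) _       _  _  ¬AB _ _ _ _ _ = contradiction b (¬AB a)
𝟙-exclusive (yes a) (no _)  (yes c) _  _  _ ¬AC _ _ _ _ = contradiction c (¬AC a)
𝟙-exclusive (no _)  (yes b) (yes c) _  _  _ _ ¬BC _ _ _ = contradiction c (¬BC b)
𝟙-exclusive (yes a) (no _)  (no _) (yes p) _ _ _ _ _ _ _ = ℕ.s≤s ℕ.z≤n
𝟙-exclusive (yes a) (no _)  (no _) (no ¬p) _ _ _ _ f _ _ = contradiction (f a) ¬p
𝟙-exclusive (no _)  (yes b) (no _) (yes p) _ _ _ _ _ _ _ = ℕ.s≤s ℕ.z≤n
𝟙-exclusive (no _)  (yes b) (no _) (no ¬p) _ _ _ _ _ g _ = contradiction (g b) ¬p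
𝟙-exclusive (no _)  (no _) (no _)  _ _ _ _ _ _ _ _ = ℕ.z≤n
𝟙-exclusive (no _)  (no _) (yes c) (yes p) _ _ _ _ _ _ _ = ℕ.s≤s ℕ.z≤n
𝟙-exclusive (no _)  (no _) (yes c) (no ¬p) (yes q) _ _ _ _ _ _ = ℕ.≤-refl
𝟙-exclusive (no _)  (no _) (yes c) (no ¬p) (no ¬q) _ _ _ _ _ h =
  [ (λ p → contradiction p ¬p) , (λ q → contradiction q ¬q) ]′ (h c)

module _ {n} {P : Fin n → Set} (P? : U.Decidable P) where

  ∈-subset⁺ : ∀ {x} → P x → x ∈ subset P?
  ∈-subset⁺ {x} px = lookup⇒[]= x _
    (trans (lookup∘tabulate (does ∘ P?) x) (dec-true (P? x) px))

  ∈-subset⁻ : ∀ {x} → x ∈ subset P? → P x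
  ∈-subset⁻ {x} x∈ with P? x | trans (sym (lookup∘tabulate (does ∘ P?) x)) ([]=⇒lookup x∈)
  ... | yes px | _ = px
  ... | no  _  | ()

∣tabulate∣ : ∀ {n} (b : Fin n → Bool) → ∣ Vec.tabulate b ∣ ≡ ∑ℕ (λ x → if b x then 1 else 0)
∣tabulate∣ {zero}  b = refl
∣tabulate∣ {suc n} b with b zero
... | true  = cong suc (∣tabulate∣ (b ∘ suc))
... | false = ∣tabulate∣ (b ∘ suc)

∣subset∣ : ∀ {n} {P : Fin n → Set} (P? : U.Decidable P) → ∣ subset P? ∣ ≡ ∑ℕ (λ x → 𝟙 (P? x))
∣subset∣ P? = ∣tabulate∣ (does ∘ P?)

-- The layer-cake formula for a single value; `k ≤ M` ensures that the range of heights does not cut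
-- `k` off.
count-< : ∀ {M} k → k ℕ.≤ M → ∑ℕ {M} (λ s → 𝟙 (toℕ s ℕ.<? k)) ≡ k
count-< {zero}  zero    _ = refl
count-< {suc M} zero    _ = count-< {M} zero ℕ.z≤n
count-< {suc M} (suc k) (ℕ.s≤s k≤M) = cong suc
  (trans (ℕΣ.sum-cong-≗ {M} λ s → 𝟙-cong (suc (toℕ s) ℕ.<? suc k) (toℕ s ℕ.<? k) ℕ.s<s⁻¹ ℕ.s≤s)
         (count-< {M} k k≤M))

n≤suc-pred : ∀ n → n ℕ.≤ suc (ℕ.pred n)
n≤suc-pred zero    = ℕ.z≤n
n≤suc-pred (suc n) = ℕ.≤-refl

-- The witness is the largest s < M satisfying P.
count-bound : ∀ M {P : ℕ → Set} (P? : U.Decidable P) lo → (∀ s → P s → lo ℕ.≤ s) →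
  let count = ∑ℕ {M} (λ s → 𝟙 (P? (toℕ s))) in
  count ≡ 0 ⊎ ∃ λ s → P s × count ℕ.+ lo ℕ.≤ suc s
count-bound zero    P? lo lo≤ = inj₁ refl
count-bound (suc M) P? lo lo≤
  with P? 0 | count-bound M (P? ∘ suc) (ℕ.pred lo) (λ s ps → ℕ.pred-mono-≤ (lo≤ (suc s) ps))
... | no  _  | inj₁ eq = inj₁ eq
-- The bound `lo` shifts to `pred lo` along with the predicate; `lo ≤ suc (pred lo)` absorbs the
-- truncation at 0.
... | no  _  | inj₂ (s , ps , le) = inj₂ (suc s , ps ,
      ℕ.≤-trans (ℕ.+-monoʳ-≤ _ (n≤suc-pred lo)) (subst (ℕ._≤ suc (suc s)) (sym (ℕ.+-suc _ (ℕ.pred lo))) (ℕ.s≤s le)))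
-- `P 0` forces `lo` to be 0. The count grows by one, matched by the shift from `s` to `suc s`, or
-- by the witness 0 if no later height counts.
... | yes p0 | rec with ℕ.n≤0⇒n≡0 (lo≤ 0 p0) | rec
...   | refl | inj₁ eq = inj₂ (0 , p0 , ℕ.s≤s (ℕ.≤-reflexive (trans (ℕ.+-identityʳ _) eq)))
...   | refl | inj₂ (s , ps , le) = inj₂ (suc s , ps , ℕ.s≤s le)

-- Discrete coarea

module _ {n} (G : Graph (suc n)) where
  open Graph G

  -- Clearing the denominator extends the bound to an empty `L ∪ R`, where the ratio is undefined
  -- but the left side is 0. Empty layers may therefore take part in the sum over heights.
  βout-*-≤ : ∀ L R → Empty (L ∩ R) →
    βout G ℚ.* ι ∣ L ∪ R ∣ ℚ.≤ ι (I G L ℕ.+ I G R ℕ.+ ∣ ∂out G (L ∪ R) ∣)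
  βout-*-≤ L R L∩R=∅ = cases (nonempty? (L ∪ R))
    where
    N = I G L ℕ.+ I G R ℕ.+ ∣ ∂out G (L ∪ R) ∣
    open ℚ.≤-Reasoning
    cases : Dec (Nonempty (L ∪ R)) → βout G ℚ.* ι ∣ L ∪ R ∣ ℚ.≤ ι N
    cases (yes ne) = begin
      βout G ℚ.* ι ∣ L ∪ R ∣
        ≤⟨ ℚ.*-monoʳ-≤-nonNeg (ι ∣ L ∪ R ∣) {{ℚ.nonNegative (0≤ι ∣ L ∪ R ∣)}}
             (βout-≤ G (L , R) (L∩R=∅ , ne)) ⟩
      bipartitenessRatio G (L , R) (L∩R=∅ , ne) ℚ.* ι ∣ L ∪ R ∣
        ≡⟨ /*ι N ∣ L ∪ R ∣ {{∣∣-nonZero ne}} ⟩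
      ι N ∎
    cases (no ¬ne) = begin
      βout G ℚ.* ι ∣ L ∪ R ∣
        ≡⟨ cong (λ k → βout G ℚ.* ι k) (trans (cong ∣_∣ (Empty-unique ¬ne)) (∣⊥∣≡0 (suc n))) ⟩
      βout G ℚ.* 0ℚ
        ≡⟨ ℚ.*-zeroʳ (βout G) ⟩
      0ℚ
        ≤⟨ 0≤ι N ⟩
      ι N ∎

  module _ (b : Fin (suc n) → Bool) (k : Fin (suc n) → ℕ) where

    private
      -- A common upper bound for all heights, so that the `s` below `M` meet every nonempty layer.
      M = ∑ℕ k

      InLayer : Bool → ℕ → Fin (suc n) → Set
      InLayer c s x = b x ≡ c × s ℕ.< k x

      inLayer? : ∀ c s → U.Decidable (InLayer c s)
      inLayer? c s x = (b x Bool.≟ c) ×-dec (s ℕ.<? k x)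

      -- In the cut at height `s`, `layer true s` plays the role of L and `layer false s` that of R.
      layer : Bool → ℕ → Subset (suc n)
      layer c s = subset (inLayer? c s)

      layers : ℕ → Subset (suc n)
      layers s = layer true s ∪ layer false s

      layer⁻ : ∀ c s {x} → x ∈ layer c s → InLayer c s x
      layer⁻ c s = ∈-subset⁻ (inLayer? c s)

      layers⁻ : ∀ s {x} → x ∈ layers s → s ℕ.< k x
      layers⁻ s x∈ = [ proj₂ ∘ layer⁻ true s , proj₂ ∘ layer⁻ false s ]′ (x∈p∪q⁻ _ _ x∈)

      layers⁺ : ∀ s {x} → s ℕ.< k x → x ∈ layers s
      layers⁺ s {x} s<kx with b x in eq
      ... | true  = x∈p∪q⁺ (inj₁ (∈-subset⁺ (inLayer? true  s) (eq , s<kx)))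
      ... | false = x∈p∪q⁺ (inj₂ (∈-subset⁺ (inLayer? false s) (eq , s<kx)))

      ∣layers∣ : ∀ s → ∣ layers s ∣ ≡ ∑ℕ (λ x → 𝟙 (s ℕ.<? k x))
      ∣layers∣ s = trans
        (cong ∣_∣ (⊆-antisym (∈-subset⁺ s<k? ∘ layers⁻ s) (layers⁺ s ∘ ∈-subset⁻ s<k?)))
        (∣subset∣ s<k?)
        where s<k? = λ x → s ℕ.<? k x

      layers-disjoint : ∀ s → Empty (layer true s ∩ layer false s)
      layers-disjoint s (x , x∈) =
        let x∈L , x∈R = x∈p∩q⁻ _ _ x∈ in
        case trans (sym (proj₁ (layer⁻ true s x∈L))) (proj₁ (layer⁻ false s x∈R)) of λ ()

      -- The ways in which `x` can be counted at height `s`. `SameSide` covers internal vertices as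
      -- well as boundary vertices reached from their own side. `OtherSide` keeps `k x ≤ s`, which
      -- holds on the outer boundary and later yields the difference `k z - k x`.
      SameSide OtherSide : Fin (suc n) → ℕ → Set
      SameSide  x s = ∃ λ y → x ∼ y × b y ≡ b x × s ℕ.< k y
      OtherSide x s = k x ℕ.≤ s × ∃ λ z → x ∼ z × b z ≢ b x × s ℕ.< k z

      sameSide? : ∀ x → U.Decidable (SameSide x)
      sameSide? x s = any? λ y → (x ∼? y) ×-dec (b y Bool.≟ b x) ×-dec (s ℕ.<? k y)

      otherSide? : ∀ x → U.Decidable (OtherSide x)
      otherSide? x s = (k x ℕ.≤? s) ×-dec
        any? λ z → (x ∼? z) ×-dec ¬? (b z Bool.≟ b x) ×-dec (s ℕ.<? k z)

      sameCount otherCount : Fin (suc n) → ℕ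
      sameCount  x = ∑ℕ {M} (λ s → 𝟙 (sameSide? x (toℕ s)))
      otherCount x = ∑ℕ {M} (λ s → 𝟙 (otherSide? x (toℕ s)))

      boundary : ℕ → ℕ
      boundary s = I G (layer true s) ℕ.+ I G (layer false s) ℕ.+ ∣ ∂out G (layers s) ∣

      boundary-≤ : ∀ s → boundary s ℕ.≤ ∑ℕ (λ x → 𝟙 (sameSide? x s) ℕ.+ 𝟙 (otherSide? x s))
      boundary-≤ s = begin
        boundary s
          ≡⟨ cong₂ ℕ._+_ (cong₂ ℕ._+_ (∣subset∣ (inI? true)) (∣subset∣ (inI? false))) (∣subset∣ in∂?) ⟩
        ∑ℕ (𝟙 ∘ inI? true) ℕ.+ ∑ℕ (𝟙 ∘ inI? false) ℕ.+ ∑ℕ (𝟙 ∘ in∂?)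
          ≡⟨ cong (ℕ._+ ∑ℕ (𝟙 ∘ in∂?)) (ℕΣ.∑-distrib-+ (𝟙 ∘ inI? true) (𝟙 ∘ inI? false)) ⟨
        ∑ℕ (λ x → 𝟙 (inI? true x) ℕ.+ 𝟙 (inI? false x)) ℕ.+ ∑ℕ (𝟙 ∘ in∂?)
          ≡⟨ ℕΣ.∑-distrib-+ (λ x → 𝟙 (inI? true x) ℕ.+ 𝟙 (inI? false x)) (𝟙 ∘ in∂?) ⟨
        ∑ℕ (λ x → 𝟙 (inI? true x) ℕ.+ 𝟙 (inI? false x) ℕ.+ 𝟙 (in∂? x))
          ≤⟨ ∑ℕ-mono-≤ (λ x → 𝟙-exclusive (inI? true x) (inI? false x) (in∂? x) (sameSide? x s) (otherSide? x s)
               (λ (x∈L , _) (x∈R , _) → layers-disjoint s (x , x∈p∩q⁺ (x∈L , x∈R)))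
               (λ (x∈L , _) (x∉ , _) → x∉ (x∈p∪q⁺ (inj₁ x∈L)))
               (λ (x∈R , _) (x∉ , _) → x∉ (x∈p∪q⁺ (inj₂ x∈R)))
               (internal true) (internal false) external) ⟩
        ∑ℕ (λ x → 𝟙 (sameSide? x s) ℕ.+ 𝟙 (otherSide? x s)) ∎
        where
        open ℕ.≤-Reasoning
        -- These repeat the decision procedures inside `I` and `∂out`, so that `∣subset∣` applies to
        -- each term of `boundary s` by unfolding.
        inI? = λ c x → (x ∈? layer c s) ×-dec any? λ y → (y ∈? layer c s) ×-dec (y ∼? x)
        in∂? = λ y → ¬? (y ∈? layers s) ×-dec any? λ x → (x ∈? layers s) ×-dec (x ∼? y)
        internal : ∀ c {x} → x ∈ layer c s × (∃ λ y → y ∈ layer c s × y ∼ x) → SameSide x s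
        internal c (x∈ , y , y∈ , y∼x) =
          let bx≡c , _ = layer⁻ c s x∈
              by≡c , s<ky = layer⁻ c s y∈
          in y , ∼-sym y∼x , trans by≡c (sym bx≡c) , s<ky
        -- An outer boundary vertex has height at most `s`; the side of its neighbour in the layers
        -- decides the alternative.
        external : ∀ {x} → ¬ x ∈ layers s × (∃ λ y → y ∈ layers s × y ∼ x) → SameSide x s ⊎ OtherSide x s
        external {x} (x∉ , y , y∈ , y∼x) with b y Bool.≟ b x
        ... | yes by≡bx = inj₁ (y , ∼-sym y∼x , by≡bx , layers⁻ s y∈)
        ... | no  by≢bx = inj₂ (ℕ.≮⇒≥ (x∉ ∘ layers⁺ s) , y , ∼-sym y∼x , by≢bx , layers⁻ s y∈)

      -- Double counting of the pairs of a height `s` and a vertex `x` with `s < k x`.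
      ∑∣layers∣ : ∑ℕ {M} (λ s → ∣ layers (toℕ s) ∣) ≡ ∑ℕ k
      ∑∣layers∣ = begin
        ∑ℕ {M} (λ s → ∣ layers (toℕ s) ∣)                  ≡⟨ ℕΣ.sum-cong-≗ {M} (∣layers∣ ∘ toℕ) ⟩
        ∑ℕ {M} (λ s → ∑ℕ (λ x → 𝟙 (toℕ s ℕ.<? k x)))      ≡⟨ ℕΣ.∑-comm {M} (λ s x → 𝟙 (toℕ s ℕ.<? k x)) ⟩
        ∑ℕ (λ x → ∑ℕ {M} (λ s → 𝟙 (toℕ s ℕ.<? k x)))      ≡⟨ ℕΣ.sum-cong-≗ (λ x → count-< (k x) (term≤∑ℕ k x)) ⟩
        ∑ℕ k                                                ∎
        where open ≡-Reasoning

      ∑boundary : ∑ℕ {M} (boundary ∘ toℕ) ℕ.≤ ∑ℕ (λ x → sameCount x ℕ.+ otherCount x)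
      ∑boundary = begin
        ∑ℕ {M} (boundary ∘ toℕ)
          ≤⟨ ∑ℕ-mono-≤ {M} (boundary-≤ ∘ toℕ) ⟩
        ∑ℕ {M} (λ s → ∑ℕ (λ x → 𝟙 (sameSide? x (toℕ s)) ℕ.+ 𝟙 (otherSide? x (toℕ s))))
          ≡⟨ ℕΣ.∑-comm {M} (λ s x → 𝟙 (sameSide? x (toℕ s)) ℕ.+ 𝟙 (otherSide? x (toℕ s))) ⟩
        ∑ℕ (λ x → ∑ℕ {M} (λ s → 𝟙 (sameSide? x (toℕ s)) ℕ.+ 𝟙 (otherSide? x (toℕ s))))
          ≡⟨ ℕΣ.sum-cong-≗ (λ x → ℕΣ.∑-distrib-+ {M} (λ s → 𝟙 (sameSide? x (toℕ s))) (λ s → 𝟙 (otherSide? x (toℕ s)))) ⟩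
        ∑ℕ (λ x → sameCount x ℕ.+ otherCount x) ∎
        where open ℕ.≤-Reasoning

    -- The bound of βout-*-≤ summed over all layers {k > s}; same x + other x is the number
    -- of layers in which x is counted on the right.
    coarea : ∃₂ λ (same other : Fin (suc n) → ℕ) →
      βout G ℚ.* ι (∑ℕ k) ℚ.≤ ι (∑ℕ (λ x → same x ℕ.+ other x)) ×
      (∀ x → same x ≡ 0 ⊎ ∃ λ y → x ∼ y × b y ≡ b x × same x ℕ.≤ k y) ×
      (∀ x → other x ≡ 0 ⊎ ∃ λ z → x ∼ z × b z ≢ b x × other x ℕ.+ k x ℕ.≤ k z)
    coarea = sameCount , otherCount , total , same-≤ , other-≤
      where
      open ℚ.≤-Reasoning
      total : βout G ℚ.* ι (∑ℕ k) ℚ.≤ ι (∑ℕ (λ x → sameCount x ℕ.+ otherCount x))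
      total = begin
        βout G ℚ.* ι (∑ℕ k)
          ≡⟨ cong (λ m → βout G ℚ.* ι m) ∑∣layers∣ ⟨
        βout G ℚ.* ι (∑ℕ {M} (λ s → ∣ layers (toℕ s) ∣))
          ≡⟨ cong (βout G ℚ.*_) (ι-∑ {M} (λ s → ∣ layers (toℕ s) ∣)) ⟩
        βout G ℚ.* ∑ℚ {M} (λ s → ι ∣ layers (toℕ s) ∣)
          ≡⟨ ℚΣ.*-distribˡ-sum {M} (βout G) (λ s → ι ∣ layers (toℕ s) ∣) ⟩
        ∑ℚ {M} (λ s → βout G ℚ.* ι ∣ layers (toℕ s) ∣)
          ≤⟨ ∑ℚ-mono-≤ {M} (λ s → βout-*-≤ (layer true (toℕ s)) (layer false (toℕ s)) (layers-disjoint (toℕ s))) ⟩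
        ∑ℚ {M} (λ s → ι (boundary (toℕ s)))
          ≡⟨ ι-∑ {M} (boundary ∘ toℕ) ⟨
        ι (∑ℕ {M} (boundary ∘ toℕ))
          ≤⟨ ι-mono-≤ ∑boundary ⟩
        ι (∑ℕ (λ x → sameCount x ℕ.+ otherCount x)) ∎
      same-≤ : ∀ x → sameCount x ≡ 0 ⊎ ∃ λ y → x ∼ y × b y ≡ b x × sameCount x ℕ.≤ k y
      -- The largest counted height `s` lies below `k y` for some admissible `y`, and at most
      -- `suc s` heights are counted.
      same-≤ x with count-bound M (sameSide? x) 0 (λ _ _ → ℕ.z≤n)
      ... | inj₁ eq = inj₁ eq
      ... | inj₂ (s , (y , x∼y , eq , s<ky) , le) = inj₂ (y , x∼y , eq ,
            ℕ.≤-trans (ℕ.m≤m+n (sameCount x) 0) (ℕ.≤-trans le s<ky))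
      other-≤ : ∀ x → otherCount x ≡ 0 ⊎ ∃ λ z → x ∼ z × b z ≢ b x × otherCount x ℕ.+ k x ℕ.≤ k z
      -- All counted heights start at `k x` or above, and the largest one lies below `k z`; hence at
      -- most `k z - k x` of them.
      other-≤ x with count-bound M (otherSide? x) (k x) (λ _ → proj₁)
      ... | inj₁ eq = inj₁ eq
      ... | inj₂ (s , (_ , z , x∼z , neq , s<kz) , le) = inj₂ (z , x∼z , neq , ℕ.≤-trans le s<kz)

0≤/ : ∀ a k .{{_ : ℕ.NonZero k}} → 0ℚ ℚ.≤ + a ℚ./ k
0≤/ a k = ℚ.nonNegative⁻¹ (+ a ℚ./ k) {{ℚ.normalize-nonNeg a k}}

-- Energy

nonNegative? : ℚ → Bool
nonNegative? p = does (0ℚ ℚ.≤? p)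

same-sign⇒0≤p*q : ∀ p q → nonNegative? q ≡ nonNegative? p → 0ℚ ℚ.≤ p ℚ.* q
same-sign⇒0≤p*q p q = cases (0ℚ ℚ.≤? p) (0ℚ ℚ.≤? q)
  where
  cases : (p? : Dec (0ℚ ℚ.≤ p)) (q? : Dec (0ℚ ℚ.≤ q)) → does q? ≡ does p? → 0ℚ ℚ.≤ p ℚ.* q
  cases (yes 0≤p) (yes 0≤q) _ = 0≤p*q 0≤p 0≤q
  cases (no  0≰p) (no  0≰q) _ = p≤0,q≤0⇒0≤p*q (ℚ.<⇒≤ (ℚ.≰⇒> 0≰p)) (ℚ.<⇒≤ (ℚ.≰⇒> 0≰q))

∑² : ∀ {n} → Vector ℚ n → ℚ
∑² f = ∑ℚ λ x → f x ℚ.* f x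

module _ {n} (G : Graph (suc n)) where
  open Graph G

  edge : Fin (suc n) → Fin (suc n) → ℚ
  edge x y = if does (x ∼? y) then 1ℚ else 0ℚ

  localEnergy : Vector ℚ (suc n) → Vector ℚ (suc n)
  localEnergy f x = ∑ℚ λ y → edge x y ℚ.* ((f x ℚ.+ f y) ℚ.* (f x ℚ.+ f y))

  -- Twice the quadratic form of the signless Laplacian (degree matrix plus adjacency matrix), since
  -- each ordered pair is counted.
  energy : Vector ℚ (suc n) → ℚ
  energy f = ∑ℚ (localEnergy f)

  private
    edge≡1 : ∀ {x y} → x ∼ y → edge x y ≡ 1ℚ
    edge≡1 {x} {y} x∼y = cong (if_then 1ℚ else 0ℚ) (dec-true (x ∼? y) x∼y)

    0≤if : ∀ b → 0ℚ ℚ.≤ (if b then 1ℚ else 0ℚ)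
    0≤if true  = 0≤1
    0≤if false = ℚ.≤-refl

    0≤1-if : ∀ b → 0ℚ ℚ.≤ 1ℚ ℚ.- (if b then 1ℚ else 0ℚ)
    0≤1-if true  = ℚ.≤-refl
    0≤1-if false = 0≤1

  module _ (f : Vector ℚ (suc n)) (u : ℚ) (0≤u : 0ℚ ℚ.≤ u) where

    private
      b : Fin (suc n) → Bool
      b = nonNegative? ∘ f

      -- The weights `same` and `1 - same` split the local energy by the side of the neighbour. The
      -- two kinds of contribution of a vertex are then charged to disjoint parts of it, which keeps
      -- the final coefficient at `1 + u`.
      term same sameTerm otherTerm : Fin (suc n) → Fin (suc n) → ℚ
      term x y = edge x y ℚ.* ((f x ℚ.+ f y) ℚ.* (f x ℚ.+ f y))
      same x y = if does (b y Bool.≟ b x) then 1ℚ else 0ℚ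
      sameTerm  x y = same x y ℚ.* term x y
      otherTerm x y = (1ℚ ℚ.- same x y) ℚ.* term x y

      0≤term : ∀ x y → 0ℚ ℚ.≤ term x y
      0≤term x y = 0≤p*q (0≤if (does (x ∼? y))) (0≤p² (f x ℚ.+ f y))

      0≤sameTerm : ∀ x y → 0ℚ ℚ.≤ sameTerm x y
      0≤sameTerm x y = 0≤p*q (0≤if (does (b y Bool.≟ b x))) (0≤term x y)

      0≤otherTerm : ∀ x y → 0ℚ ℚ.≤ otherTerm x y
      0≤otherTerm x y = 0≤p*q (0≤1-if (does (b y Bool.≟ b x))) (0≤term x y)

      sameTerm+otherTerm : ∀ x → ∑ℚ (sameTerm x) ℚ.+ ∑ℚ (otherTerm x) ≡ localEnergy f x
      sameTerm+otherTerm x = trans (sym (ℚΣ.∑-distrib-+ (sameTerm x) (otherTerm x)))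
        (ℚΣ.sum-cong-≗ λ y → solve 2 (λ s t → s :* t :+ (con 1ℚ :- s) :* t := t) refl (same x y) (term x y))

      sameTerm≡ : ∀ {x y} → x ∼ y → b y ≡ b x → sameTerm x y ≡ (f x ℚ.+ f y) ℚ.* (f x ℚ.+ f y)
      sameTerm≡ {x} {y} x∼y eq = trans
        (cong₂ (λ s e → s ℚ.* (e ℚ.* ((f x ℚ.+ f y) ℚ.* (f x ℚ.+ f y))))
          (cong (if_then 1ℚ else 0ℚ) (dec-true (b y Bool.≟ b x) eq)) (edge≡1 x∼y))
        (solve 1 (λ t → con 1ℚ :* (con 1ℚ :* t) := t) refl ((f x ℚ.+ f y) ℚ.* (f x ℚ.+ f y)))

      otherTerm≡ : ∀ {x y} → x ∼ y → b y ≢ b x → otherTerm x y ≡ (f x ℚ.+ f y) ℚ.* (f x ℚ.+ f y)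
      otherTerm≡ {x} {y} x∼y neq = trans
        (cong₂ (λ s e → (1ℚ ℚ.- s) ℚ.* (e ℚ.* ((f x ℚ.+ f y) ℚ.* (f x ℚ.+ f y))))
          (cong (if_then 1ℚ else 0ℚ) (dec-false (b y Bool.≟ b x) neq)) (edge≡1 x∼y))
        (solve 1 (λ t → (con 1ℚ :- con 0ℚ) :* (con 1ℚ :* t) := t) refl ((f x ℚ.+ f y) ℚ.* (f x ℚ.+ f y)))

    module _ (D : ℕ) (k : Fin (suc n) → ℕ) (k≡ : ∀ x → ι (k x) ≡ ι D ℚ.* (f x ℚ.* f x)) where

      private
        D* : ∀ {p q} → p ℚ.≤ q → ι D ℚ.* p ℚ.≤ ι D ℚ.* q
        D* = ℚ.*-monoˡ-≤-nonNeg (ι D) {{ℚ.nonNegative (0≤ι D)}}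

      -- On one side `f x` and `f y` have a nonnegative product, so `(f y)²` is at most
      -- `(f x + f y)²`, a single term of the sum.
      same-bound : ∀ {c} x → c ≡ 0 ⊎ (∃ λ y → x ∼ y × b y ≡ b x × c ℕ.≤ k y) →
        ι c ℚ.≤ ι D ℚ.* ∑ℚ (sameTerm x)
      same-bound x (inj₁ refl) = 0≤p*q (0≤ι D) (0≤∑ℚ (0≤sameTerm x))
      same-bound {c} x (inj₂ (y , x∼y , eq , c≤)) = begin
        ι c                           ≤⟨ ι-mono-≤ c≤ ⟩
        ι (k y)                       ≡⟨ k≡ y ⟩
        ι D ℚ.* (f y ℚ.* f y)         ≤⟨ D* (p+r≡q⇒p≤q 0≤rest (expand (f x) (f y))) ⟩
        ι D ℚ.* ((f x ℚ.+ f y) ℚ.* (f x ℚ.+ f y))   ≡⟨ cong (ι D ℚ.*_) (sameTerm≡ x∼y eq) ⟨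
        ι D ℚ.* sameTerm x y          ≤⟨ D* (term≤∑ℚ (0≤sameTerm x) y) ⟩
        ι D ℚ.* ∑ℚ (sameTerm x)       ∎
        where
        open ℚ.≤-Reasoning
        0≤fxfy : 0ℚ ℚ.≤ f x ℚ.* f y
        0≤fxfy = same-sign⇒0≤p*q (f x) (f y) eq
        0≤rest : 0ℚ ℚ.≤ f x ℚ.* f x ℚ.+ (f x ℚ.* f y ℚ.+ f x ℚ.* f y)
        0≤rest = 0≤p+q (0≤p² (f x)) (0≤p+q 0≤fxfy 0≤fxfy)
        expand : ∀ p q → q ℚ.* q ℚ.+ (p ℚ.* p ℚ.+ (p ℚ.* q ℚ.+ p ℚ.* q)) ≡ (p ℚ.+ q) ℚ.* (p ℚ.+ q)
        expand = solve 2 (λ p q → q :* q :+ (p :* p :+ (p :* q :+ p :* q)) := (p :+ q) :* (p :+ q)) refl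

      -- Here `c` is at most `D` times `(f z)² - (f x)²`. This difference can exceed the edge energy
      -- `(f x + f z)²`, and the term `u² (f x)²` pays for the excess by completing a square.
      other-bound : ∀ {c} x → c ≡ 0 ⊎ (∃ λ z → x ∼ z × b z ≢ b x × c ℕ.+ k x ℕ.≤ k z) →
        u ℚ.* ι c ℚ.≤ ι D ℚ.* ((1ℚ ℚ.+ u) ℚ.* ∑ℚ (otherTerm x) ℚ.+ u ℚ.* u ℚ.* (f x ℚ.* f x))
      other-bound x (inj₁ refl) = ℚ.≤-trans (ℚ.≤-reflexive (ℚ.*-zeroʳ u))
        (0≤p*q (0≤ι D) (0≤p+q (0≤p*q (0≤p+q 0≤1 0≤u) (0≤∑ℚ (0≤otherTerm x)))
          (0≤p*q (0≤p² u) (0≤p² (f x)))))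
      other-bound {c} x (inj₂ (z , x∼z , neq , c≤)) = begin
        u ℚ.* ι c
          ≤⟨ ℚ.*-monoˡ-≤-nonNeg u {{ℚ.nonNegative 0≤u}} c≤′ ⟩
        u ℚ.* (ι D ℚ.* (f z ℚ.* f z) ℚ.- ι D ℚ.* (f x ℚ.* f x))
          ≡⟨ solve 4 (λ u d p q → u :* (d :* (q :* q) :- d :* (p :* p)) := d :* (u :* (q :* q :- p :* p)))
               refl u (ι D) (f x) (f z) ⟩
        ι D ℚ.* (u ℚ.* (f z ℚ.* f z ℚ.- f x ℚ.* f x))
          ≤⟨ D* (p+r≡q⇒p≤q (0≤p² (f x ℚ.+ f z ℚ.+ u ℚ.* f x)) (complete-square u (f x) (f z))) ⟩
        ι D ℚ.* ((1ℚ ℚ.+ u) ℚ.* ((f x ℚ.+ f z) ℚ.* (f x ℚ.+ f z)) ℚ.+ u ℚ.* u ℚ.* (f x ℚ.* f x))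
          ≡⟨ cong (λ t → ι D ℚ.* ((1ℚ ℚ.+ u) ℚ.* t ℚ.+ u ℚ.* u ℚ.* (f x ℚ.* f x))) (otherTerm≡ x∼z neq) ⟨
        ι D ℚ.* ((1ℚ ℚ.+ u) ℚ.* otherTerm x z ℚ.+ u ℚ.* u ℚ.* (f x ℚ.* f x))
          ≤⟨ D* (ℚ.+-monoˡ-≤ (u ℚ.* u ℚ.* (f x ℚ.* f x))
               (ℚ.*-monoˡ-≤-nonNeg (1ℚ ℚ.+ u) {{ℚ.nonNegative (0≤p+q 0≤1 0≤u)}} (term≤∑ℚ (0≤otherTerm x) z))) ⟩
        ι D ℚ.* ((1ℚ ℚ.+ u) ℚ.* ∑ℚ (otherTerm x) ℚ.+ u ℚ.* u ℚ.* (f x ℚ.* f x)) ∎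
        where
        open ℚ.≤-Reasoning
        c≤′ : ι c ℚ.≤ ι D ℚ.* (f z ℚ.* f z) ℚ.- ι D ℚ.* (f x ℚ.* f x)
        c≤′ = begin
          ι c                                   ≡⟨ solve 2 (λ c k → c := c :+ k :- k) refl (ι c) (ι (k x)) ⟩
          ι c ℚ.+ ι (k x) ℚ.- ι (k x)           ≡⟨ cong (ℚ._- ι (k x)) (ι-+ c (k x)) ⟨
          ι (c ℕ.+ k x) ℚ.- ι (k x)             ≤⟨ ℚ.+-monoˡ-≤ (ℚ.- ι (k x)) (ι-mono-≤ c≤) ⟩
          ι (k z) ℚ.- ι (k x)                   ≡⟨ cong₂ ℚ._-_ (k≡ z) (k≡ x) ⟩
          ι D ℚ.* (f z ℚ.* f z) ℚ.- ι D ℚ.* (f x ℚ.* f x) ∎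
        -- With e = p + q the difference of the two sides is (e + u p)², whatever the signs.
        complete-square : ∀ u p q →
          u ℚ.* (q ℚ.* q ℚ.- p ℚ.* p) ℚ.+ (p ℚ.+ q ℚ.+ u ℚ.* p) ℚ.* (p ℚ.+ q ℚ.+ u ℚ.* p) ≡
          (1ℚ ℚ.+ u) ℚ.* ((p ℚ.+ q) ℚ.* (p ℚ.+ q)) ℚ.+ u ℚ.* u ℚ.* (p ℚ.* p)
        complete-square = solve 3 (λ u p q →
          u :* (q :* q :- p :* p) :+ (p :+ q :+ u :* p) :* (p :+ q :+ u :* p) :=
          (con 1ℚ :+ u) :* ((p :+ q) :* (p :+ q)) :+ u :* u :* (p :* p)) refl

      local-bound : ∀ {c c′} x →
        c ≡ 0 ⊎ (∃ λ y → x ∼ y × b y ≡ b x × c ℕ.≤ k y) →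
        c′ ≡ 0 ⊎ (∃ λ z → x ∼ z × b z ≢ b x × c′ ℕ.+ k x ℕ.≤ k z) →
        u ℚ.* ι (c ℕ.+ c′) ℚ.≤
          ι D ℚ.* ((1ℚ ℚ.+ u) ℚ.* localEnergy f x ℚ.+ u ℚ.* u ℚ.* (f x ℚ.* f x))
      local-bound {c} {c′} x c≤ c′≤ = begin
        u ℚ.* ι (c ℕ.+ c′)
          ≡⟨ trans (cong (u ℚ.*_) (ι-+ c c′)) (ℚ.*-distribˡ-+ u (ι c) (ι c′)) ⟩
        u ℚ.* ι c ℚ.+ u ℚ.* ι c′
          ≤⟨ ℚ.+-mono-≤ (ℚ.*-monoˡ-≤-nonNeg u {{ℚ.nonNegative 0≤u}} (same-bound x c≤)) (other-bound x c′≤) ⟩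
        u ℚ.* (ι D ℚ.* S) ℚ.+ ι D ℚ.* ((1ℚ ℚ.+ u) ℚ.* O ℚ.+ U)
          -- One further copy of `S` raises its coefficient from `u` to `1 + u`, so that `S` and `O`
          -- recombine into the local energy.
          ≤⟨ p+r≡q⇒p≤q (0≤p*q (0≤ι D) (0≤∑ℚ (0≤sameTerm x))) (regroup u (ι D) S O U) ⟩
        ι D ℚ.* ((1ℚ ℚ.+ u) ℚ.* (S ℚ.+ O) ℚ.+ U)
          ≡⟨ cong (λ s → ι D ℚ.* ((1ℚ ℚ.+ u) ℚ.* s ℚ.+ U)) (sameTerm+otherTerm x) ⟩
        ι D ℚ.* ((1ℚ ℚ.+ u) ℚ.* localEnergy f x ℚ.+ U) ∎
        where
        open ℚ.≤-Reasoning
        S = ∑ℚ (sameTerm x)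
        O = ∑ℚ (otherTerm x)
        U = u ℚ.* u ℚ.* (f x ℚ.* f x)
        regroup : ∀ u d s o v →
          u ℚ.* (d ℚ.* s) ℚ.+ d ℚ.* ((1ℚ ℚ.+ u) ℚ.* o ℚ.+ v) ℚ.+ d ℚ.* s ≡
          d ℚ.* ((1ℚ ℚ.+ u) ℚ.* (s ℚ.+ o) ℚ.+ v)
        regroup = solve 5 (λ u d s o v →
          u :* (d :* s) :+ d :* ((con 1ℚ :+ u) :* o :+ v) :+ d :* s :=
          d :* ((con 1ℚ :+ u) :* (s :+ o) :+ v)) refl

    -- Applies `coarea` to the heights `D (f x)²` with sides given by the sign of `f`, sums the
    -- local bounds and cancels the positive scale `D`.
    βout-energy : u ℚ.* (βout G ℚ.* ∑² f) ℚ.≤ (1ℚ ℚ.+ u) ℚ.* energy f ℚ.+ u ℚ.* u ℚ.* ∑² f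
    βout-energy =
      let D , k , D≢0 , k≡ = common-denominator (λ x → f x ℚ.* f x) (λ x → 0≤p² (f x))
          c , c′ , total , c≤ , c′≤ = coarea G b k
          instance
            _ = D≢0
            _ = ℚ.positive (0<ι D)
      in ℚ.*-cancelˡ-≤-pos (ι D) (begin
        ι D ℚ.* (u ℚ.* (βout G ℚ.* ∑² f))
          ≡⟨ swap (ι D) u (βout G) (∑² f) ⟩
        u ℚ.* (βout G ℚ.* (ι D ℚ.* ∑² f))
          ≡⟨ cong (λ t → u ℚ.* (βout G ℚ.* t)) (trans (ℚΣ.*-distribˡ-sum (ι D) (λ x → f x ℚ.* f x))
               (trans (ℚΣ.sum-cong-≗ (sym ∘ k≡)) (sym (ι-∑ k)))) ⟩
        u ℚ.* (βout G ℚ.* ι (∑ℕ k))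
          ≤⟨ ℚ.*-monoˡ-≤-nonNeg u {{ℚ.nonNegative 0≤u}} total ⟩
        u ℚ.* ι (∑ℕ (λ x → c x ℕ.+ c′ x))
          ≡⟨ trans (cong (u ℚ.*_) (ι-∑ (λ x → c x ℕ.+ c′ x)))
               (ℚΣ.*-distribˡ-sum u (λ x → ι (c x ℕ.+ c′ x))) ⟩
        ∑ℚ (λ x → u ℚ.* ι (c x ℕ.+ c′ x))
          ≤⟨ ∑ℚ-mono-≤ (λ x → local-bound D k k≡ x (c≤ x) (c′≤ x)) ⟩
        ∑ℚ (λ x → ι D ℚ.* ((1ℚ ℚ.+ u) ℚ.* localEnergy f x ℚ.+ u ℚ.* u ℚ.* (f x ℚ.* f x)))
          ≡⟨ ℚΣ.*-distribˡ-sum (ι D) (λ x → (1ℚ ℚ.+ u) ℚ.* localEnergy f x ℚ.+ u ℚ.* u ℚ.* (f x ℚ.* f x)) ⟨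
        ι D ℚ.* ∑ℚ (λ x → (1ℚ ℚ.+ u) ℚ.* localEnergy f x ℚ.+ u ℚ.* u ℚ.* (f x ℚ.* f x))
          ≡⟨ cong (ι D ℚ.*_) (trans
               (ℚΣ.∑-distrib-+ (λ x → (1ℚ ℚ.+ u) ℚ.* localEnergy f x) (λ x → u ℚ.* u ℚ.* (f x ℚ.* f x)))
               (sym (cong₂ ℚ._+_ (ℚΣ.*-distribˡ-sum (1ℚ ℚ.+ u) (localEnergy f))
                                 (ℚΣ.*-distribˡ-sum (u ℚ.* u) (λ x → f x ℚ.* f x))))) ⟩
        ι D ℚ.* ((1ℚ ℚ.+ u) ℚ.* energy f ℚ.+ u ℚ.* u ℚ.* ∑² f) ∎)
      where
      open ℚ.≤-Reasoning
      swap : ∀ d u β s → d ℚ.* (u ℚ.* (β ℚ.* s)) ≡ u ℚ.* (β ℚ.* (d ℚ.* s))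
      swap = solve 4 (λ d u β s → d :* (u :* (β :* s)) := u :* (β :* (d :* s))) refl

  -- With `u = w - 1`, `F = ∑² f` and `E = energy f`, `βout-energy` reads `u β F ≤ w E + u² F`. As
  -- `β ≥ w² - 1 = u (w + 1)`, the left side is at least `u² (w + 1) F`, which leaves
  -- `w u² F ≤ w E`. Only an upper bound on `w²` enters, so a rational lower approximation of the
  -- root can serve as `w`.
  energy-bound : ∀ f w → 1ℚ ℚ.≤ w → w ℚ.* w ℚ.≤ 1ℚ ℚ.+ βout G →
    (w ℚ.- 1ℚ) ℚ.* (w ℚ.- 1ℚ) ℚ.* ∑² f ℚ.≤ energy f
  energy-bound f w 1≤w w²≤ = ℚ.*-cancelˡ-≤-pos w {{ℚ.positive (ℚ.<-≤-trans (ℚ.positive⁻¹ 1ℚ) 1≤w)}}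
    (p+r≡q⇒p≤q
      (0≤p+q (p≤q⇒0≤q-p (βout-energy f (w ℚ.- 1ℚ) 0≤w-1))
             (0≤p*q 0≤w-1 (0≤p*q (p≤q⇒0≤q-p w²≤) (0≤∑ℚ (λ x → 0≤p² (f x))))))
      (identity w (βout G) (∑² f) (energy f)))
    where
    0≤w-1 = p≤q⇒0≤q-p 1≤w
    identity : ∀ w β F E → let u = w ℚ.- 1ℚ in
      w ℚ.* (u ℚ.* u ℚ.* F) ℚ.+
        (((1ℚ ℚ.+ u) ℚ.* E ℚ.+ u ℚ.* u ℚ.* F ℚ.- u ℚ.* (β ℚ.* F)) ℚ.+
         u ℚ.* ((1ℚ ℚ.+ β ℚ.- w ℚ.* w) ℚ.* F)) ≡ w ℚ.* E
    identity = solve 4 (λ w β F E → let u = w :- con 1ℚ in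
      w :* (u :* u :* F) :+
        (((con 1ℚ :+ u) :* E :+ u :* u :* F :- u :* (β :* F)) :+
         u :* ((con 1ℚ :+ β :- w :* w) :* F)) := w :* E) refl

  -- Energy on a regular graph

  module _ (d : ℕ) (regular : Regular G d) where

    edge-sym : ∀ x y → edge x y ≡ edge y x
    edge-sym x y = cases (x ∼? y) (y ∼? x)
      where
      cases : (p : Dec (x ∼ y)) (q : Dec (y ∼ x)) →
        (if does p then 1ℚ else 0ℚ) ≡ (if does q then 1ℚ else 0ℚ)
      cases (yes _) (yes _) = refl
      cases (no  _) (no  _) = refl
      cases (yes p) (no ¬q) = contradiction (∼-sym p) ¬q
      cases (no ¬p) (yes q) = contradiction (∼-sym q) ¬p

    ∑edge : ∀ x → ∑ℚ (edge x) ≡ ι d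
    ∑edge x = begin
      -- `degree` decides `y ∼ x` while `edge x y` decides `x ∼ y`, hence the appeal to symmetry.
      ∑ℚ (edge x)                    ≡⟨ ℚΣ.sum-cong-≗ (λ y → trans (edge-sym x y) (sym (ι-if (does (y ∼? x))))) ⟩
      ∑ℚ (λ y → ι (𝟙 (y ∼? x)))      ≡⟨ ι-∑ (λ y → 𝟙 (y ∼? x)) ⟨
      ι (∑ℕ (λ y → 𝟙 (y ∼? x)))      ≡⟨ cong ι (∣subset∣ (_∼? x)) ⟨
      ι (degree G x)                 ≡⟨ cong ι (regular x) ⟩
      ι d                            ∎
      where
      open ≡-Reasoning
      ι-if : ∀ b → ι (if b then 1 else 0) ≡ (if b then 1ℚ else 0ℚ)
      ι-if true  = refl
      ι-if false = refl

    -- Expanding the square leaves two diagonal sums and a doubled cross term. Regularity evaluates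
    -- the first diagonal sum, and exchanging the summations with `edge-sym` reduces the other to
    -- it.
    energy≡ : ∀ f → let Q = ∑ℚ (λ x → f x ℚ.* ∑ℚ (λ y → edge x y ℚ.* f y)) in
      energy f ≡ ι d ℚ.* ∑² f ℚ.+ (Q ℚ.+ Q) ℚ.+ ι d ℚ.* ∑² f
    energy≡ f = begin
      energy f
        ≡⟨ ℚΣ.sum-cong-≗ (λ x → trans (ℚΣ.sum-cong-≗ (λ y → expand (edge x y) (f x) (f y))) (split x)) ⟩
      ∑ℚ (λ x → A x ℚ.+ (B x ℚ.+ B x) ℚ.+ C x)
        ≡⟨ trans (ℚΣ.∑-distrib-+ (λ x → A x ℚ.+ (B x ℚ.+ B x)) C)
            (cong (ℚ._+ ∑ℚ C) (trans (ℚΣ.∑-distrib-+ A (λ x → B x ℚ.+ B x))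
              (cong (∑ℚ A ℚ.+_) (ℚΣ.∑-distrib-+ B B)))) ⟩
      ∑ℚ A ℚ.+ (∑ℚ B ℚ.+ ∑ℚ B) ℚ.+ ∑ℚ C
        ≡⟨ cong₂ ℚ._+_ (cong₂ ℚ._+_ ∑A (cong₂ ℚ._+_ ∑B ∑B)) ∑C ⟩
      ι d ℚ.* ∑² f ℚ.+ (Q ℚ.+ Q) ℚ.+ ι d ℚ.* ∑² f ∎
      where
      open ≡-Reasoning
      Q = ∑ℚ (λ x → f x ℚ.* ∑ℚ (λ y → edge x y ℚ.* f y))
      a b c : Fin (suc n) → Fin (suc n) → ℚ
      a x y = edge x y ℚ.* (f x ℚ.* f x)
      b x y = f x ℚ.* (edge x y ℚ.* f y)
      c x y = edge x y ℚ.* (f y ℚ.* f y)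
      A B C : Fin (suc n) → ℚ
      A x = ∑ℚ (a x)
      B x = ∑ℚ (b x)
      C x = ∑ℚ (c x)
      expand : ∀ e p q → e ℚ.* ((p ℚ.+ q) ℚ.* (p ℚ.+ q)) ≡
        e ℚ.* (p ℚ.* p) ℚ.+ (p ℚ.* (e ℚ.* q) ℚ.+ p ℚ.* (e ℚ.* q)) ℚ.+ e ℚ.* (q ℚ.* q)
      expand = solve 3 (λ e p q → e :* ((p :+ q) :* (p :+ q)) :=
        e :* (p :* p) :+ (p :* (e :* q) :+ p :* (e :* q)) :+ e :* (q :* q)) refl
      split : ∀ x → ∑ℚ (λ y → a x y ℚ.+ (b x y ℚ.+ b x y) ℚ.+ c x y) ≡ A x ℚ.+ (B x ℚ.+ B x) ℚ.+ C x
      split x = trans (ℚΣ.∑-distrib-+ (λ y → a x y ℚ.+ (b x y ℚ.+ b x y)) (c x))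
        (cong (ℚ._+ C x) (trans (ℚΣ.∑-distrib-+ (a x) (λ y → b x y ℚ.+ b x y))
          (cong (A x ℚ.+_) (ℚΣ.∑-distrib-+ (b x) (b x)))))
      ∑A : ∑ℚ A ≡ ι d ℚ.* ∑² f
      ∑A = trans
        (ℚΣ.sum-cong-≗ λ x → trans (sym (ℚΣ.*-distribʳ-sum (f x ℚ.* f x) (edge x))) (cong (ℚ._* (f x ℚ.* f x)) (∑edge x)))
        (sym (ℚΣ.*-distribˡ-sum (ι d) (λ x → f x ℚ.* f x)))
      ∑B : ∑ℚ B ≡ Q
      ∑B = ℚΣ.sum-cong-≗ λ x → sym (ℚΣ.*-distribˡ-sum (f x) (λ y → edge x y ℚ.* f y))
      ∑C : ∑ℚ C ≡ ι d ℚ.* ∑² f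
      ∑C = trans (ℚΣ.∑-comm c)
        (trans (ℚΣ.sum-cong-≗ λ y → ℚΣ.sum-cong-≗ λ x → cong (ℚ._* (f y ℚ.* f y)) (edge-sym x y)) ∑A)

-- Square-root approximations from below

module _ (q : ℚ) (1≤q : 1ℚ ℚ.≤ q) (m : ℕ) where

  private
    a = ℤ.∣ ℚ.↥ q ∣
    b = ℚ.↧ₙ q
    K = suc m
    r = isqrt (a ℕ.* b ℕ.* (K ℕ.* K))

    w*bK : √-seq q m ℚ.* ι (b ℕ.* K) ≡ ι r
    w*bK = /*ι r (b ℕ.* K)

    q*b : q ℚ.* ι b ≡ ι a
    q*b = sym (↥≡*↧ q (ℚ.≤-trans 0≤1 1≤q))

    b≤a : b ℕ.≤ a
    b≤a = go q 1≤q
      where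
      go : ∀ q → 1ℚ ℚ.≤ q → ℚ.↧ₙ q ℕ.≤ ℤ.∣ ℚ.↥ q ∣
      go (ℚ.mkℚ (+ a) d _) (ℚ.*≤* le) = ℤ.drop‿+≤+
        (subst₂ ℤ._≤_ (ℤ.*-identityˡ (+ suc d)) (ℤ.*-identityʳ (+ a)) le)
      go (ℚ.mkℚ -[1+ _ ] _ _) (ℚ.*≤* ())

    -- Otherwise `(suc r)² ≤ (b K)² ≤ a b K²` by `b ≤ a`, against the upper half of `isqrt-spec`.
    bK≤r : b ℕ.* K ℕ.≤ r
    bK≤r = ℕ.≮⇒≥ λ r<bK → ℕ.<⇒≱ (proj₂ (isqrt-spec (a ℕ.* b ℕ.* (K ℕ.* K)))) (begin
      suc r ℕ.* suc r               ≤⟨ ℕ.*-mono-≤ r<bK r<bK ⟩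
      b ℕ.* K ℕ.* (b ℕ.* K)         ≡⟨ shuffle b K ⟩
      b ℕ.* b ℕ.* (K ℕ.* K)         ≤⟨ ℕ.*-monoˡ-≤ (K ℕ.* K) (ℕ.*-monoˡ-≤ b b≤a) ⟩
      a ℕ.* b ℕ.* (K ℕ.* K)         ∎)
      where
      open ℕ.≤-Reasoning
      shuffle : ∀ b k → b ℕ.* k ℕ.* (b ℕ.* k) ≡ b ℕ.* b ℕ.* (k ℕ.* k)
      shuffle = ℕRing.solve-∀

    instance
      bK⁺ : ℚ.Positive (ι (b ℕ.* K))
      bK⁺ = ℚ.positive (0<ι (b ℕ.* K))

  1≤√-seq : 1ℚ ℚ.≤ √-seq q m
  1≤√-seq = ℚ.*-cancelʳ-≤-pos (ι (b ℕ.* K)) (subst₂ ℚ._≤_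
    (sym (ℚ.*-identityˡ (ι (b ℕ.* K)))) (sym w*bK) (ι-mono-≤ bK≤r))

  -- `isqrt` rounds down, so `r² ≤ a b K²`; dividing by `(b K)²` gives `a / b = q`.
  √-seq²≤ : √-seq q m ℚ.* √-seq q m ℚ.≤ q
  √-seq²≤ = ℚ.*-cancelʳ-≤-pos B (ℚ.*-cancelʳ-≤-pos B (begin
    w ℚ.* w ℚ.* B ℚ.* B               ≡⟨ solve 2 (λ w c → w :* w :* c :* c := w :* c :* (w :* c)) refl w B ⟩
    w ℚ.* B ℚ.* (w ℚ.* B)             ≡⟨ cong₂ ℚ._*_ w*bK w*bK ⟩
    ι r ℚ.* ι r                       ≡⟨ ι-* r r ⟨
    ι (r ℕ.* r)                       ≤⟨ ι-mono-≤ (proj₁ (isqrt-spec (a ℕ.* b ℕ.* (K ℕ.* K)))) ⟩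
    ι (a ℕ.* b ℕ.* (K ℕ.* K))         ≡⟨ trans (ι-* (a ℕ.* b) (K ℕ.* K)) (cong₂ ℚ._*_ (ι-* a b) (ι-* K K)) ⟩
    ι a ℚ.* ι b ℚ.* (ι K ℚ.* ι K)     ≡⟨ cong (λ t → t ℚ.* ι b ℚ.* (ι K ℚ.* ι K)) q*b ⟨
    q ℚ.* ι b ℚ.* ι b ℚ.* (ι K ℚ.* ι K)
      ≡⟨ solve 3 (λ q b k → q :* b :* b :* (k :* k) := q :* (b :* k) :* (b :* k)) refl q (ι b) (ι K) ⟩
    q ℚ.* (ι b ℚ.* ι K) ℚ.* (ι b ℚ.* ι K)   ≡⟨ cong (λ t → q ℚ.* t ℚ.* t) (ι-* b K) ⟨
    q ℚ.* B ℚ.* B                     ∎))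
    where
    open ℚ.≤-Reasoning
    w = √-seq q m
    B = ι (b ℕ.* K)

0≤βout : ∀ {n} (G : Graph (suc n)) → 0ℚ ℚ.≤ βout G
0≤βout G = from-attained (βout-attained G)
  where
  from-attained : (∃₂ λ LR a → βout G ≡ bipartitenessRatio G LR a) → 0ℚ ℚ.≤ βout G
  from-attained ((L , R) , (_ , ne) , eq) = ℚ.≤-trans
    (0≤/ (I G L ℕ.+ I G R ℕ.+ ∣ ∂out G (L ∪ R) ∣) ∣ L ∪ R ∣ {{∣∣-nonZero ne}})
    (ℚ.≤-reflexive (sym eq))

-- Null sequences

-- `x ≈ y` unfolds to `Null` of the termwise difference, so equations between reals pass directly to
-- and from null sequences.
Null : (ℕ → ℚ) → Set
Null s = ∀ ε → 0ℚ ℚ.< ε → ∃ λ N → ∀ n → N ℕ.≤ n → ℚ.∣ s n ∣ ℚ.< ε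

Null-resp : ∀ {s t} → (∀ n → s n ≡ t n) → Null s → Null t
Null-resp s≡t null ε 0<ε =
  let N , s< = null ε 0<ε
  in N , λ n ≤n → subst (λ z → ℚ.∣ z ∣ ℚ.< ε) (s≡t n) (s< n ≤n)

Null-neg : ∀ {s} → Null s → Null (λ n → ℚ.- s n)
Null-neg {s} null ε 0<ε =
  let N , s< = null ε 0<ε
  in N , λ n ≤n → subst (ℚ._< ε) (sym (ℚ.∣-p∣≡∣p∣ (s n))) (s< n ≤n)

Null-+ : ∀ {s t} → Null s → Null t → Null (λ n → s n ℚ.+ t n)
Null-+ {s} {t} null null′ ε 0<ε =
  let M , s< = null (½ ℚ.* ε) (0<½* 0<ε)
      N , t< = null′ (½ ℚ.* ε) (0<½* 0<ε)
  in M ℕ.⊔ N , λ n ≤n → split-< (s n) (t n) (s< n (⊔ˡ ≤n)) (t< n (⊔ʳ {M} ≤n))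

Null-* : ∀ x {s} → Null s → Null (λ n → seq x n ℚ.* s n)
Null-* x {s} null ε 0<ε =
  let B , M , 0<B , x≤ = bound x
      δ , 0<δ , x*< = scale 0<B 0<ε
      N , s< = null δ 0<δ
  in M ℕ.⊔ N , λ n ≤n → x*< (seq x n) (s n) (x≤ n (⊔ˡ ≤n)) (s< n (⊔ʳ {M} ≤n))

Null-∑ : ∀ {k} {s : Fin k → ℕ → ℚ} → (∀ i → Null (s i)) → Null (λ n → ∑ℚ λ i → s i n)
Null-∑ {zero}  null ε 0<ε = 0 , λ _ _ → 0<ε
Null-∑ {suc k} null = Null-+ (null zero) (Null-∑ (null ∘ suc))

seq-∑ : ∀ {k} (v : Vector ℝ k) n → seq (∑ v) n ≡ ∑ℚ (λ i → seq (v i) n)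
seq-∑ {zero}  v n = refl
seq-∑ {suc k} v n = cong (seq (v zero) n ℚ.+_) (seq-∑ (v ∘ suc) n)

seq-· : ∀ {k} (M : Matrix k) v i m →
  seq ((M · v) i) m ≡ ∑ℚ (λ j → seq (M i j) m ℚ.* seq (v j) m)
seq-· M v i m = seq-∑ (λ j → M i j * v j) m

-- The eigenvalue equation holds only in the limit; this is the error left by the approximations at
-- index `m`.
residual : ∀ {k} → Matrix k → ℝ → Vector ℝ k → Fin k → ℕ → ℚ
residual M μ v i m = ∑ℚ (λ j → seq (M i j) m ℚ.* seq (v j) m) ℚ.- seq μ m ℚ.* seq (v i) m

residual-null : ∀ {k} (M : Matrix k) μ v i → (M · v) i ≈ μ * v i → Null (residual M μ v i)
residual-null M μ v i = Null-resp λ m → cong (ℚ._- seq μ m ℚ.* seq (v i) m) (seq-· M v i m)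

p≤∣p∣ : ∀ p → p ℚ.≤ ℚ.∣ p ∣
p≤∣p∣ p = [ (λ 0≤p → ℚ.≤-reflexive (sym (ℚ.0≤p⇒∣p∣≡p 0≤p)))
          , (λ p≤0 → ℚ.≤-trans p≤0 (ℚ.0≤∣p∣ p)) ]′ (ℚ.≤-total 0ℚ p)

p²<ε²⇒∣p∣<ε : ∀ p ε → 0ℚ ℚ.< ε → p ℚ.* p ℚ.< ε ℚ.* ε → ℚ.∣ p ∣ ℚ.< ε
p²<ε²⇒∣p∣<ε p ε 0<ε p²<ε² = ℚ.≰⇒> λ ε≤∣p∣ → ℚ.<-irrefl refl (begin-strict
  ε ℚ.* ε                ≤⟨ ℚ.*-monoˡ-≤-nonNeg ε {{ℚ.nonNegative (ℚ.<⇒≤ 0<ε)}} ε≤∣p∣ ⟩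
  ε ℚ.* ℚ.∣ p ∣          ≤⟨ ℚ.*-monoʳ-≤-nonNeg ℚ.∣ p ∣ {{ℚ.∣-∣-nonNeg p}} ε≤∣p∣ ⟩
  ℚ.∣ p ∣ ℚ.* ℚ.∣ p ∣    ≡⟨ ℚ.∣p*q∣≡∣p∣*∣q∣ p p ⟨
  ℚ.∣ p ℚ.* p ∣          ≡⟨ ℚ.0≤p⇒∣p∣≡p (0≤p² p) ⟩
  p ℚ.* p                <⟨ p²<ε² ⟩
  ε ℚ.* ε                ∎)
  where open ℚ.≤-Reasoning

0<p*q : ∀ {p q} → 0ℚ ℚ.< p → 0ℚ ℚ.< q → 0ℚ ℚ.< p ℚ.* q
0<p*q {p} {q} 0<p 0<q = subst (ℚ._< p ℚ.* q) (ℚ.*-zeroʳ p)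
  (ℚ.*-monoʳ-<-pos p {{ℚ.positive 0<p}} 0<q)

-- The order on ℝ is ¬¬-stable: a modulus of convergence decides y - x < ε against y - x > ε/4.
≤-cancel-*-null : ∀ x y (F E : ℕ → ℚ) → Null E → ¬ Null F → (∀ n → 0ℚ ℚ.≤ F n) →
  (∀ n → seq y n ℚ.* F n ℚ.≤ seq x n ℚ.* F n ℚ.+ E n) → y ≤ x
≤-cancel-*-null x y F E E→0 F↛0 0≤F yF≤ ε 0<ε = cases (z N ℚ.<? ½ ℚ.* ε)
  where
  open ℚ.≤-Reasoning
  -- Beyond `N` the values of `z` differ by less than a quarter of `ε`, so the threshold `ε/2` for
  -- `z N` keeps `z n` either below `3ε/4` or at least `ε/4`.
  η = ½ ℚ.* (½ ℚ.* ε)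
  0<η : 0ℚ ℚ.< η
  0<η = 0<½* (0<½* 0<ε)
  z : ℕ → ℚ
  z = seq (y - x)
  N = proj₁ (cauchy (y - x) η 0<η)
  near : ∀ m n → N ℕ.≤ m → N ℕ.≤ n → z m ℚ.< z n ℚ.+ η
  near m n ≤m ≤n = begin-strict
    z m                      ≡⟨ solve 2 (λ a b → a := b :+ (a :- b)) refl (z m) (z n) ⟩
    z n ℚ.+ (z m ℚ.- z n)    ≤⟨ ℚ.+-monoʳ-≤ (z n) (p≤∣p∣ (z m ℚ.- z n)) ⟩
    z n ℚ.+ ℚ.∣ z m ℚ.- z n ∣ <⟨ ℚ.+-monoʳ-< (z n) (proj₂ (cauchy (y - x) η 0<η) m n ≤m ≤n) ⟩
    z n ℚ.+ η                ∎
  η+η : η ℚ.+ η ≡ ½ ℚ.* ε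
  η+η = ½+½ (½ ℚ.* ε)
  cases : Dec (z N ℚ.< ½ ℚ.* ε) → ∃ λ N → ∀ n → N ℕ.≤ n → seq y n ℚ.< seq x n ℚ.+ ε
  cases (yes zN<) = N , λ n ≤n → begin-strict
    seq y n                              ≡⟨ solve 2 (λ a b → a := b :+ (a :- b)) refl (seq y n) (seq x n) ⟩
    seq x n ℚ.+ z n                      <⟨ ℚ.+-monoʳ-< (seq x n) (near n N ≤n ℕ.≤-refl) ⟩
    seq x n ℚ.+ (z N ℚ.+ η)              <⟨ ℚ.+-monoʳ-< (seq x n) (ℚ.+-monoˡ-< η zN<) ⟩
    seq x n ℚ.+ (½ ℚ.* ε ℚ.+ η)          ≤⟨ ℚ.+-monoʳ-≤ (seq x n) (ℚ.+-monoʳ-≤ (½ ℚ.* ε)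
                                              (p+r≡q⇒p≤q (ℚ.<⇒≤ 0<η) η+η)) ⟩
    seq x n ℚ.+ (½ ℚ.* ε ℚ.+ ½ ℚ.* ε)    ≡⟨ cong (seq x n ℚ.+_) (½+½ ε) ⟩
    seq x n ℚ.+ ε                        ∎
  -- Now `z` is eventually at least `η`, so `η F ≤ z F ≤ E` would make `F` null.
  cases (no zN≮) = contradiction F→0 F↛0
    where
    η≤z : ∀ n → N ℕ.≤ n → η ℚ.≤ z n
    η≤z n ≤n = begin
      η                      ≡⟨ solve 1 (λ a → a := a :+ a :- a) refl η ⟩
      η ℚ.+ η ℚ.- η          ≡⟨ cong (ℚ._- η) η+η ⟩
      ½ ℚ.* ε ℚ.- η          ≤⟨ ℚ.+-monoˡ-≤ (ℚ.- η) (ℚ.≮⇒≥ zN≮) ⟩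
      z N ℚ.- η              ≤⟨ ℚ.+-monoˡ-≤ (ℚ.- η) (ℚ.<⇒≤ (near N n ℕ.≤-refl ≤n)) ⟩
      z n ℚ.+ η ℚ.- η        ≡⟨ solve 2 (λ a b → a :+ b :- b := a) refl (z n) η ⟩
      z n                    ∎
    F→0 : Null F
    F→0 δ 0<δ =
      -- The tolerance for `E` carries the factor `η` that is cancelled from `η F` afterwards.
      let M , E< = E→0 (η ℚ.* δ) (0<p*q 0<η 0<δ)
      in N ℕ.⊔ M , λ n ≤n → subst (ℚ._< δ) (sym (ℚ.0≤p⇒∣p∣≡p (0≤F n)))
        (ℚ.*-cancelˡ-<-nonNeg η {{ℚ.nonNegative (ℚ.<⇒≤ 0<η)}} (begin-strict
          η ℚ.* F n              ≤⟨ ℚ.*-monoʳ-≤-nonNeg (F n) {{ℚ.nonNegative (0≤F n)}} (η≤z n (⊔ˡ ≤n)) ⟩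
          z n ℚ.* F n            ≤⟨ p+r≡q⇒p≤q (p≤q⇒0≤q-p (yF≤ n)) (rearrange (seq x n) (seq y n) (F n) (E n)) ⟩
          E n                    ≤⟨ p≤∣p∣ (E n) ⟩
          ℚ.∣ E n ∣              <⟨ E< n (⊔ʳ {N} ≤n) ⟩
          η ℚ.* δ                ∎))
      where
      rearrange : ∀ a b f e → (b ℚ.- a) ℚ.* f ℚ.+ (a ℚ.* f ℚ.+ e ℚ.- b ℚ.* f) ≡ e
      rearrange = solve 4 (λ a b f e → (b :- a) :* f :+ (a :* f :+ e :- b :* f) := e) refl

-- Each square is bounded by the sum, taken with tolerance `ε²`. Contraposition turns `v≉0` into the
-- statement that the sum of squares is not null.
∑²-null⇒null : ∀ {k} (v : Vector ℝ k) → Null (λ n → ∑² (λ i → seq (v i) n)) → ∀ i → v i ≈ 0ℝ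
∑²-null⇒null v ∑²→0 i = Null-resp (λ n → sym (ℚ.+-identityʳ (seq (v i) n))) λ ε 0<ε →
  let N , ∑²< = ∑²→0 (ε ℚ.* ε) (0<p*q 0<ε 0<ε)
  in N , λ n ≤n → p²<ε²⇒∣p∣<ε (seq (v i) n) ε 0<ε
    (ℚ.≤-<-trans (ℚ.≤-trans (term≤∑ℚ (λ j → 0≤p² (seq (v j) n)) i) (p≤∣p∣ _)) (∑²< n ≤n))

-- Eigenvalues

module _ {n} (M L : Matrix n)
  (L≡I-M : ∀ i j m → seq (L i j) m ≡ seq (identityMatrix i j) m ℚ.- seq (M i j) m) where

  seq-identity· : ∀ {k} (v : Vector ℝ k) i m →
    ∑ℚ (λ j → seq (identityMatrix i j) m ℚ.* seq (v j) m) ≡ seq (v i) m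
  seq-identity· {suc k} v zero    m = trans
    (cong₂ ℚ._+_ (ℚ.*-identityˡ (seq (v zero) m))
      (trans (ℚΣ.sum-cong-≗ λ j → ℚ.*-zeroˡ (seq (v (suc j)) m)) (ℚΣ.sum-replicate-zero k)))
    (ℚ.+-identityʳ (seq (v zero) m))
  seq-identity· {suc k} v (suc i) m = trans
    (cong₂ ℚ._+_ (ℚ.*-zeroˡ (seq (v zero) m)) (trans (ℚΣ.sum-cong-≗ same) (seq-identity· (v ∘ suc) i m)))
    (ℚ.+-identityˡ (seq (v (suc i)) m))
    where
    same : ∀ j → seq (identityMatrix (suc i) (suc j)) m ℚ.* seq (v (suc j)) m ≡
                 seq (identityMatrix i j) m ℚ.* seq (v (suc j)) m
    same j with i ≟ j
    ... | yes _ = refl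
    ... | no  _ = refl

  seq-L· : ∀ v i m → seq ((L · v) i) m ≡ seq (v i) m ℚ.- seq ((M · v) i) m
  seq-L· v i m = begin
    seq ((L · v) i) m
      ≡⟨ seq-· L v i m ⟩
    ∑ℚ (λ j → seq (L i j) m ℚ.* w j)
      ≡⟨ ℚΣ.sum-cong-≗ (λ j → trans (cong (ℚ._* w j) (L≡I-M i j m)) (expand (e j) (a j) (w j))) ⟩
    ∑ℚ (λ j → e j ℚ.* w j ℚ.+ ℚ.- 1ℚ ℚ.* (a j ℚ.* w j))
      ≡⟨ ℚΣ.∑-distrib-+ (λ j → e j ℚ.* w j) (λ j → ℚ.- 1ℚ ℚ.* (a j ℚ.* w j)) ⟩
    ∑ℚ (λ j → e j ℚ.* w j) ℚ.+ ∑ℚ (λ j → ℚ.- 1ℚ ℚ.* (a j ℚ.* w j))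
      ≡⟨ cong₂ ℚ._+_ (seq-identity· v i m) (sym (ℚΣ.*-distribˡ-sum (ℚ.- 1ℚ) (λ j → a j ℚ.* w j))) ⟩
    w i ℚ.+ ℚ.- 1ℚ ℚ.* ∑ℚ (λ j → a j ℚ.* w j)
      ≡⟨ solve 2 (λ w s → w :+ :- con 1ℚ :* s := w :- s) refl (w i) (∑ℚ (λ j → a j ℚ.* w j)) ⟩
    w i ℚ.- ∑ℚ (λ j → a j ℚ.* w j)
      ≡⟨ cong (λ s → w i ℚ.- s) (seq-· M v i m) ⟨
    w i ℚ.- seq ((M · v) i) m ∎
    where
    open ≡-Reasoning
    e a w : Fin n → ℚ
    e j = seq (identityMatrix i j) m
    a j = seq (M i j) m
    w j = seq (v j) m
    expand : ∀ e a w → (e ℚ.- a) ℚ.* w ≡ e ℚ.* w ℚ.+ ℚ.- 1ℚ ℚ.* (a ℚ.* w)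
    expand = solve 3 (λ e a w → (e :- a) :* w := e :* w :+ :- con 1ℚ :* (a :* w)) refl

  -- The same vector works: its residual for `L` at `1 - μ` is the negated residual for `M` at `μ`.
  eigenvalue-L : ∀ {μ} → IsEigenvalue M μ → IsEigenvalue L (1ℝ - μ)
  eigenvalue-L {μ} (v , v≉0 , Mv≈μv) = v , v≉0 , λ i → Null-resp
    (λ m → trans (identity (seq (v i) m) (seq ((M · v) i) m) (seq μ m))
      (cong (ℚ._- seq ((1ℝ - μ) * v i) m) (sym (seq-L· v i m))))
    (Null-neg (Mv≈μv i))
    where
    identity : ∀ w s μ → ℚ.- (s ℚ.- μ ℚ.* w) ≡ (w ℚ.- s) ℚ.- (1ℚ ℚ.- μ) ℚ.* w
    identity = solve 3 (λ w s μ → :- (s :- μ :* w) := (w :- s) :- (con 1ℚ :- μ) :* w) refl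

  eigenvalue-L⁻ : ∀ {ν} → IsEigenvalue L ν → IsEigenvalue M (1ℝ - ν)
  eigenvalue-L⁻ {ν} (v , v≉0 , Lv≈νv) = v , v≉0 , λ i → Null-resp
    (λ m → trans (cong (λ s → ℚ.- (s ℚ.- seq ν m ℚ.* seq (v i) m)) (seq-L· v i m))
      (identity (seq (v i) m) (seq ((M · v) i) m) (seq ν m)))
    (Null-neg (Lv≈νv i))
    where
    identity : ∀ w s ν → ℚ.- ((w ℚ.- s) ℚ.- ν ℚ.* w) ≡ s ℚ.- (1ℚ ℚ.- ν) ℚ.* w
    identity = solve 3 (λ w s ν → :- ((w :- s) :- ν :* w) := s :- (con 1ℚ :- ν) :* w) refl

  -- Extremality is applied to the transported eigenvalues: `1 - t` belongs to `L`, so `1 - t ≤ λN`,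
  -- and `1 - λN` belongs to `M`, so `t ≤ 1 - λN`. Shifting both by rational constants gives the two
  -- halves of the distance estimate.
  2-largest≈1+smallest : ∀ {λN t} → IsLargestEigenvalue L λN → IsSmallestEigenvalue M t →
    2ℝ - λN ≈ 1ℝ + t
  2-largest≈1+smallest {λN} {t} (eigL , largest) (eigM , smallest) ε 0<ε =
    let K , 1-t< = largest (1ℝ - t) (eigenvalue-L {t} eigM) ε 0<ε
        N , t<   = smallest (1ℝ - λN) (eigenvalue-L⁻ {λN} eigL) ε 0<ε
    in K ℕ.⊔ N , λ m ≤m →
      let l = seq λN m
          s = seq t m
          2ℚ = + 2 ℚ./ 1
      in ∣-∣-< {2ℚ ℚ.- l} {1ℚ ℚ.+ s}
        (subst₂ ℚ._<_ (solve 2 (λ l s → con 1ℚ :- s :+ (con 1ℚ :+ s :- l) := con 2ℚ :- l) refl l s)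
          (solve 3 (λ l s e → l :+ e :+ (con 1ℚ :+ s :- l) := con 1ℚ :+ s :+ e) refl l s ε)
          (ℚ.+-monoˡ-< (1ℚ ℚ.+ s ℚ.- l) (1-t< m (⊔ˡ ≤m))))
        (subst₂ ℚ._<_ (ℚ.+-comm s 1ℚ)
          (solve 2 (λ l e → con 1ℚ :- l :+ e :+ con 1ℚ := con 2ℚ :- l :+ e) refl l ε)
          (ℚ.+-monoˡ-< 1ℚ (t< m (⊔ʳ {K} ≤m))))

-- Rayleigh quotient and the spectral bound

module _ {n} (G : Graph (suc n)) (d : ℕ) .{{d≢0 : ℕ.NonZero d}} (regular : Regular G d)
  (M : Matrix (suc n)) (edge≡dM : ∀ x y m → edge G x y ≡ ι d ℚ.* seq (M x y) m)
  (t : ℝ) (v : Vector ℝ (suc n)) (Mv≈tv : ∀ i → (M · v) i ≈ t * v i) where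

  private
    instance
      2d≢0 : ℕ.NonZero (2 ℕ.* d)
      2d≢0 = m*n≢0 2 d

    f : ℕ → Vector ℚ (suc n)
    f m x = seq (v x) m

    ρ : ℚ
    ρ = + 1 ℚ./ (2 ℕ.* d)

    r : Fin (suc n) → ℕ → ℚ
    r = residual (M) t v

    -- The inner product of the approximate eigenvector with its residual: the amount by which its
    -- quadratic form under `M` misses `t ∑² f`.
    error : ℕ → ℚ
    error m = ∑ℚ λ x → f m x ℚ.* r x m

    error-null : Null error
    error-null = Null-∑ {s = λ x m → f m x ℚ.* r x m} λ x →
      Null-* (v x) {r x} (residual-null (M) t v x (Mv≈tv x))

    neighbour-sum : ∀ x m → ∑ℚ (λ y → edge G x y ℚ.* f m y) ≡ ι d ℚ.* (seq t m ℚ.* f m x ℚ.+ r x m)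
    neighbour-sum x m = begin
      ∑ℚ (λ y → edge G x y ℚ.* f m y)
        ≡⟨ ℚΣ.sum-cong-≗ (λ y → trans (cong (ℚ._* f m y) (edge≡dM x y m)) (ℚ.*-assoc (ι d) (seq (M x y) m) (f m y))) ⟩
      ∑ℚ (λ y → ι d ℚ.* (seq (M x y) m ℚ.* f m y))
        ≡⟨ ℚΣ.*-distribˡ-sum (ι d) (λ y → seq (M x y) m ℚ.* f m y) ⟨
      ι d ℚ.* ∑ℚ (λ y → seq (M x y) m ℚ.* f m y)
        ≡⟨ cong (ι d ℚ.*_) (add-back (∑ℚ (λ y → seq (M x y) m ℚ.* f m y)) (seq t m ℚ.* f m x)) ⟩
      ι d ℚ.* (seq t m ℚ.* f m x ℚ.+ r x m) ∎
      where
      open ≡-Reasoning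
      add-back : ∀ p q → p ≡ q ℚ.+ (p ℚ.- q)
      add-back = solve 2 (λ p q → p := q :+ (p :- q)) refl

    quadratic-form : ∀ m → ∑ℚ (λ x → f m x ℚ.* ∑ℚ (λ y → edge G x y ℚ.* f m y)) ≡
      ι d ℚ.* (seq t m ℚ.* ∑² (f m) ℚ.+ error m)
    quadratic-form m = begin
      ∑ℚ (λ x → f m x ℚ.* ∑ℚ (λ y → edge G x y ℚ.* f m y))
        ≡⟨ ℚΣ.sum-cong-≗ (λ x → trans (cong (f m x ℚ.*_) (neighbour-sum x m))
             (solve 4 (λ w d t r → w :* (d :* (t :* w :+ r)) := d :* (t :* (w :* w) :+ w :* r)) refl
               (f m x) (ι d) (seq t m) (r x m))) ⟩
      ∑ℚ (λ x → ι d ℚ.* (seq t m ℚ.* (f m x ℚ.* f m x) ℚ.+ f m x ℚ.* r x m))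
        ≡⟨ ℚΣ.*-distribˡ-sum (ι d) (λ x → seq t m ℚ.* (f m x ℚ.* f m x) ℚ.+ f m x ℚ.* r x m) ⟨
      ι d ℚ.* ∑ℚ (λ x → seq t m ℚ.* (f m x ℚ.* f m x) ℚ.+ f m x ℚ.* r x m)
        ≡⟨ cong (ι d ℚ.*_) (trans
             (ℚΣ.∑-distrib-+ (λ x → seq t m ℚ.* (f m x ℚ.* f m x)) (λ x → f m x ℚ.* r x m))
             (cong (ℚ._+ error m) (sym (ℚΣ.*-distribˡ-sum (seq t m) (λ x → f m x ℚ.* f m x))))) ⟩
      ι d ℚ.* (seq t m ℚ.* ∑² (f m) ℚ.+ error m) ∎
      where open ≡-Reasoning

    -- On a `d`-regular graph the energy is `2d` times the quadratic form of the identity plus `M`;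
    -- the factor `ρ` removes the `2d`.
    rayleigh : ∀ m → energy G (f m) ℚ.* ρ ≡ (1ℚ ℚ.+ seq t m) ℚ.* ∑² (f m) ℚ.+ error m
    rayleigh m = begin
      energy G (f m) ℚ.* ρ
        ≡⟨ cong (ℚ._* ρ) (trans (energy≡ G d regular (f m))
             (cong (λ q → ι d ℚ.* F ℚ.+ (q ℚ.+ q) ℚ.+ ι d ℚ.* F) (quadratic-form m))) ⟩
      (ι d ℚ.* F ℚ.+ (Q ℚ.+ Q) ℚ.+ ι d ℚ.* F) ℚ.* ρ
        ≡⟨ solve 5 (λ d f t e r → (d :* f :+ (d :* (t :* f :+ e) :+ d :* (t :* f :+ e)) :+ d :* f) :* r :=
                     (con (+ 2 ℚ./ 1) :* d :* r) :* ((con 1ℚ :+ t) :* f :+ e)) refl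
             (ι d) F (seq t m) (error m) ρ ⟩
      (ι 2 ℚ.* ι d ℚ.* ρ) ℚ.* ((1ℚ ℚ.+ seq t m) ℚ.* F ℚ.+ error m)
        ≡⟨ cong (ℚ._* ((1ℚ ℚ.+ seq t m) ℚ.* F ℚ.+ error m))
             (trans (cong (ℚ._* ρ) (sym (ι-* 2 d))) (ι*1/ (2 ℕ.* d))) ⟩
      1ℚ ℚ.* ((1ℚ ℚ.+ seq t m) ℚ.* F ℚ.+ error m)
        ≡⟨ ℚ.*-identityˡ _ ⟩
      (1ℚ ℚ.+ seq t m) ℚ.* F ℚ.+ error m ∎
      where
      open ≡-Reasoning
      F = ∑² (f m)
      Q = ι d ℚ.* (seq t m ℚ.* F ℚ.+ error m)

  -- At every index the rational vector `f m` and the lower approximation `w` satisfy `energy-bound`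
  -- exactly; `rayleigh` converts it into the desired inequality times `∑² (f m)`, up to `error m`.
  -- As `v` is nonzero, `∑² (f m)` is not null, so this factor can be cancelled in the limit.
  eigenvalue-bound : ¬ (∀ i → v i ≈ 0ℝ) →
    1ℝ + t ≥ ((√ (1ℚ ℚ.+ βout G) - 1ℝ) ²) / (2 ℕ.* d)
  eigenvalue-bound v≉0 = ≤-cancel-*-null (1ℝ + t) (((√ q - 1ℝ) ²) / (2 ℕ.* d))
    (λ m → ∑² (f m)) error error-null (v≉0 ∘ ∑²-null⇒null v)
    (λ m → 0≤∑ℚ (λ x → 0≤p² (f m x)))
    λ m → let w = √-seq q m ; u = w ℚ.- 1ℚ in begin
      u ℚ.* u ℚ.* ρ ℚ.* ∑² (f m)
        ≡⟨ solve 3 (λ u r F → u :* u :* r :* F := u :* u :* F :* r) refl u ρ (∑² (f m)) ⟩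
      u ℚ.* u ℚ.* ∑² (f m) ℚ.* ρ
        ≤⟨ ℚ.*-monoʳ-≤-nonNeg ρ {{ℚ.normalize-nonNeg 1 (2 ℕ.* d)}}
             (energy-bound G (f m) w (1≤√-seq q 1≤q m) (√-seq²≤ q 1≤q m)) ⟩
      energy G (f m) ℚ.* ρ
        ≡⟨ rayleigh m ⟩
      (1ℚ ℚ.+ seq t m) ℚ.* ∑² (f m) ℚ.+ error m ∎
    where
    open ℚ.≤-Reasoning
    q = 1ℚ ℚ.+ βout G
    1≤q : 1ℚ ℚ.≤ q
    1≤q = p+r≡q⇒p≤q (0≤βout G) refl

edge≡d*normalizedAdjacency : ∀ {n} (G : Graph (suc n)) d .{{_ : ℕ.NonZero d}} x y m →
  edge G x y ≡ ι d ℚ.* seq (normalizedAdjacency G d x y) m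
edge≡d*normalizedAdjacency G d x y m = sym (d*[e/d] (does (Graph._∼?_ G x y)))
  where
  d*[e/d] : ∀ e → ι d ℚ.* seq ((if e then 1ℝ else 0ℝ) / d) m ≡ (if e then 1ℚ else 0ℚ)
  d*[e/d] true  = trans (cong (ι d ℚ.*_) (ℚ.*-identityˡ (+ 1 ℚ./ d))) (ι*1/ d)
  d*[e/d] false = trans (cong (ι d ℚ.*_) (ℚ.*-zeroˡ (+ 1 ℚ./ d))) (ℚ.*-zeroʳ (ι d))

mainTheorem4 : ∀ {n} (G : Graph (suc n)) (d : ℕ) .{{_ : ℕ.NonZero d}} → Regular G d →
    (λN t₁ : ℝ) →
    IsLargestEigenvalue (normalizedLaplacian G d) λN →
    IsSmallestEigenvalue (normalizedAdjacency G d) t₁ →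
    (2ℝ - λN ≈ 1ℝ + t₁) ×
    (1ℝ + t₁ ≥ _/_ ((√ (1ℚ ℚ.+ βout G) - 1ℝ) ²) (2 ℕ.* d) {{m*n≢0 2 d}})
-- Naming the instance matters: an instance argument left to be inferred defeats the
-- syntactic comparison of the types, and Agda unfolds the Cauchy proofs instead.
mainTheorem4 G d {{d≢0}} regular λN t₁ largest smallest@((v , v≉0 , Mv≈t₁v) , _) =
  2-largest≈1+smallest (normalizedAdjacency G d {{d≢0}}) (normalizedLaplacian G d {{d≢0}})
    (λ _ _ _ → refl) {λN} {t₁} largest smallest ,
  eigenvalue-bound G d {{d≢0}} regular (normalizedAdjacency G d {{d≢0}})
    (edge≡d*normalizedAdjacency G d {{d≢0}}) t₁ v Mv≈t₁v v≉0
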